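{- For every $k\ge 3$ and every point $(x_1,\ldots,x_k)$ of the $k$-simplex, $$d_k(x_1,\ldots,x_k)\le\begin{cases}2.014096 & \text{if } x_1,x_2\le 6/11,\\ 11/12 & \text{otherwise.}\end{cases}$$
   Context: The $k$-simplex is $\{x\in\mathbb{R}^k: x\ge 0,\ \sum_i x_i=1\}$. Let $F(z)=\min\{(11/6)z,1\}$ for $z\in[0,1]$, and let $F'(z)=11/6$ for $z\in[0,6/11]$ and $F'(z)=0$ otherwise. For a point $(x_1,\dots,x_k)$ of the $k$-simplex define $$d_k(x_1,\ldots,x_k)=\frac{1}{k!}\sum_{\sigma}\Big(F'(x_1)\prod_{i:\sigma(i)<\sigma(1)}[1-F(x_i)]+F'(x_2)\prod_{i:\sigma(i)<\sigma(2)}[1-F(x_i)]\Big),$$ the sum being over all permutations $\sigma$ of $\{1,\dots,k\}$. (Interpretation: ICUT is the random cut of the simplex in which $\rho_1,\dots,\rho_k$ are chosen independently and uniformly in $[0,6/11]$ and, in a uniformly random order $\sigma$ of the terminals, terminal $i$ captures all not-yet-captured points with $x_i\ge\rho_i$; $d_k(x_1,\dots,x_k)$ is the density, i.e. expected number of cuts divided by length (half the $L_1$ norm), with which ICUT cuts an infinitesimal segment at $x$ parallel to the edge joining vertices $1$ and $2$ of the simplex.) -}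

module Defs where

open import Data.Fin.Base using (Fin; zero; suc; punchIn)
import Data.Fin.Properties as Fin
open import Data.Fin.Permutation using (Permutation′; id; insert; insert-remove; remove; _⟨$⟩ʳ_; _≈_)
open import Data.Integer.Base using (+_)
open import Data.List.Base using (List; []; _∷_; [_]; allFin; cartesianProductWith; filter; foldr; length; map)
open import Data.List.Membership.Propositional using (_∈_)
open import Data.List.Membership.Propositional.Properties using (∈-allFin; ∈-cartesianProductWith⁺)
open import Data.List.Properties using (length-++; length-map; length-tabulate)
open import Data.List.Relation.Unary.Any using (here)
open import Data.Nat.Base as ℕ using (ℕ; zero; suc; _!)
open import Data.Nat.Properties as ℕ using (_!≢0)
open import Data.Product.Base using (∃-syntax; Σ-syntax; _×_; _,_; proj₁; proj₂)
open import Data.Rational.Base as ℚ using (ℚ; 0ℚ; 1ℚ; ½; _/_; ∣_∣)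
open import Data.Rational.Properties as ℚ using ()
open import Data.Rational.Solver using (module +-*-Solver)
open import Data.Sum.Base using (inj₁; inj₂)
open import Relation.Binary.PropositionalEquality using (_≡_; refl; sym; trans; cong; cong₂; subst; subst₂)
open import Relation.Nullary.Decidable using (Dec; yes; no)

------------------------------------------------------------------------
-- Real numbers, as Cauchy sequences of rationals.  There is no quotient:
-- equality of reals is _≈ᵣ_.

IsCauchy : (ℕ → ℚ) → Set
IsCauchy s = ∀ ε → 0ℚ ℚ.< ε →
  ∃[ N ] ∀ m n → N ℕ.≤ m → N ℕ.≤ n → ∣ s m ℚ.- s n ∣ ℚ.≤ ε

record ℝ : Set where
  constructor mkℝ
  field
    seq    : ℕ → ℚ
    cauchy : IsCauchy seq

open ℝ public

infix 4 _≤ᵣ_ _≈ᵣ_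

_≤ᵣ_ : ℝ → ℝ → Set
x ≤ᵣ y = ∀ ε → 0ℚ ℚ.< ε →
  ∃[ N ] ∀ n → N ℕ.≤ n → seq x n ℚ.≤ seq y n ℚ.+ ε

_≈ᵣ_ : ℝ → ℝ → Set
x ≈ᵣ y = (x ≤ᵣ y) × (y ≤ᵣ x)

module CauchyLemmas where

  Bounded : (ℕ → ℚ) → Set
  Bounded s = Σ[ B ∈ ℚ ] 0ℚ ℚ.< B × ∃[ N ] ∀ n → N ℕ.≤ n → ∣ s n ∣ ℚ.≤ B

  abstract

    half>0 : ∀ ε → 0ℚ ℚ.< ε → 0ℚ ℚ.< ½ ℚ.* ε
    half>0 ε ε>0 = subst (ℚ._< ½ ℚ.* ε) (ℚ.*-zeroʳ ½) (ℚ.*-monoʳ-<-pos ½ ε>0)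

    half+half : ∀ ε → ½ ℚ.* ε ℚ.+ ½ ℚ.* ε ≡ ε
    half+half ε = trans (sym (ℚ.*-distribʳ-+ ε ½ ½)) (ℚ.*-identityˡ ε)

    p≤∣p∣ : ∀ p → p ℚ.≤ ∣ p ∣
    p≤∣p∣ p with ℚ.≤-total 0ℚ p
    ... | inj₁ 0≤p = ℚ.≤-reflexive (sym (ℚ.0≤p⇒∣p∣≡p 0≤p))
    ... | inj₂ p≤0 = ℚ.≤-trans p≤0 (ℚ.0≤∣p∣ p)

    sub-add : ∀ p q → (p ℚ.- q) ℚ.+ q ≡ p
    sub-add = solve 2 (λ p q → (p :- q) :+ q := p) refl
      where open +-*-Solver

    add-sub : ∀ p q → (q ℚ.+ p) ℚ.- q ≡ p
    add-sub = solve 2 (λ p q → (q :+ p) :- q := p) refl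
      where open +-*-Solver

    neg-sub : ∀ p q → ℚ.- (p ℚ.- q) ≡ q ℚ.- p
    neg-sub = solve 2 (λ p q → :- (p :- q) := q :- p) refl
      where open +-*-Solver

    close⇒≤ : ∀ {p q ε} → ∣ p ℚ.- q ∣ ℚ.≤ ε → p ℚ.≤ q ℚ.+ ε
    close⇒≤ {p} {q} {ε} h = subst₂ ℚ._≤_ (sub-add p q) (ℚ.+-comm ε q)
      (ℚ.+-monoˡ-≤ q (ℚ.≤-trans (p≤∣p∣ (p ℚ.- q)) h))

    ≤⇒sub : ∀ {p q ε} → p ℚ.≤ q ℚ.+ ε → p ℚ.- q ℚ.≤ ε
    ≤⇒sub {p} {q} {ε} h = subst (p ℚ.- q ℚ.≤_) (add-sub ε q) (ℚ.+-monoˡ-≤ (ℚ.- q) h)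

    ≤⇒close : ∀ {p q ε} → p ℚ.≤ q ℚ.+ ε → q ℚ.≤ p ℚ.+ ε → ∣ p ℚ.- q ∣ ℚ.≤ ε
    ≤⇒close {p} {q} {ε} h₁ h₂ with ℚ.∣p∣≡p∨∣p∣≡-p (p ℚ.- q)
    ... | inj₁ e = subst (ℚ._≤ ε) (sym e) (≤⇒sub h₁)
    ... | inj₂ e = subst (ℚ._≤ ε) (sym (trans e (neg-sub p q))) (≤⇒sub h₂)

    ⊔-≤ˡ : ∀ {M N n} → M ℕ.⊔ N ℕ.≤ n → M ℕ.≤ n
    ⊔-≤ˡ {M} {N} = ℕ.m⊔n≤o⇒m≤o M N

    ⊔-≤ʳ : ∀ {M N n} → M ℕ.⊔ N ℕ.≤ n → N ℕ.≤ n
    ⊔-≤ʳ {M} {N} = ℕ.m⊔n≤o⇒n≤o M N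

    +-cauchy : ∀ {s t} → IsCauchy s → IsCauchy t → IsCauchy (λ n → s n ℚ.+ t n)
    +-cauchy {s} {t} cs ct ε ε>0 with cs (½ ℚ.* ε) (half>0 ε ε>0) | ct (½ ℚ.* ε) (half>0 ε ε>0)
    ... | M , f | N , g = M ℕ.⊔ N , λ m n hm hn →
      subst₂ ℚ._≤_ (cong ∣_∣ (rearrange (s m) (s n) (t m) (t n))) (half+half ε)
        (ℚ.≤-trans (ℚ.∣p+q∣≤∣p∣+∣q∣ (s m ℚ.- s n) (t m ℚ.- t n))
                   (ℚ.+-mono-≤ (f m n (⊔-≤ˡ hm) (⊔-≤ˡ hn)) (g m n (⊔-≤ʳ hm) (⊔-≤ʳ hn))))
      where
      rearrange : ∀ a b c d → (a ℚ.- b) ℚ.+ (c ℚ.- d) ≡ (a ℚ.+ c) ℚ.- (b ℚ.+ d)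
      rearrange = solve 4 (λ a b c d → (a :- b) :+ (c :- d) := (a :+ c) :- (b :+ d)) refl
        where open +-*-Solver

    neg-cauchy : ∀ {s} → IsCauchy s → IsCauchy (λ n → ℚ.- s n)
    neg-cauchy {s} cs ε ε>0 with cs ε ε>0
    ... | N , f = N , λ m n hm hn →
      subst (ℚ._≤ ε) (cong ∣_∣ (rearrange (s n) (s m))) (f n m hn hm)
      where
      rearrange : ∀ a b → a ℚ.- b ≡ (ℚ.- b) ℚ.- (ℚ.- a)
      rearrange = solve 2 (λ a b → a :- b := (:- b) :- (:- a)) refl
        where open +-*-Solver

    ⊓-cauchy : ∀ {s t} → IsCauchy s → IsCauchy t → IsCauchy (λ n → s n ℚ.⊓ t n)
    ⊓-cauchy {s} {t} cs ct ε ε>0 with cs ε ε>0 | ct ε ε>0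
    ... | M , f | N , g = M ℕ.⊔ N , λ m n hm hn → ≤⇒close {s m ℚ.⊓ t m} {s n ℚ.⊓ t n} (below m n hm hn) (below n m hn hm)
      where
      below : ∀ m n → M ℕ.⊔ N ℕ.≤ m → M ℕ.⊔ N ℕ.≤ n → s m ℚ.⊓ t m ℚ.≤ (s n ℚ.⊓ t n) ℚ.+ ε
      below m n hm hn = subst (s m ℚ.⊓ t m ℚ.≤_)
        (sym (ℚ.mono-≤-distrib-⊓ {ℚ._+ ε} (ℚ.+-monoˡ-≤ ε) (s n) (t n)))
        (ℚ.⊓-mono-≤ {s m} {s n ℚ.+ ε} {t m} {t n ℚ.+ ε}
                    (close⇒≤ {s m} {s n} (f m n (⊔-≤ˡ hm) (⊔-≤ˡ hn)))
                    (close⇒≤ {t m} {t n} (g m n (⊔-≤ʳ hm) (⊔-≤ʳ hn))))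

    cauchy⇒bounded : ∀ {s} → IsCauchy s → Bounded s
    cauchy⇒bounded {s} cs with cs 1ℚ (ℚ.positive⁻¹ 1ℚ)
    ... | N , f = 1ℚ ℚ.+ ∣ s N ∣
                , ℚ.+-mono-<-≤ (ℚ.positive⁻¹ 1ℚ) (ℚ.0≤∣p∣ (s N))
                , N
                , λ n hn → ℚ.≤-trans
                    (subst (λ z → ∣ z ∣ ℚ.≤ ∣ s n ℚ.- s N ∣ ℚ.+ ∣ s N ∣) (sub-add (s n) (s N))
                           (ℚ.∣p+q∣≤∣p∣+∣q∣ (s n ℚ.- s N) (s N)))
                    (ℚ.+-monoˡ-≤ ∣ s N ∣ (f n N hn ℕ.≤-refl))

    divide : ∀ B ε → 0ℚ ℚ.< B → 0ℚ ℚ.< ε → Σ[ δ ∈ ℚ ] 0ℚ ℚ.< δ × B ℚ.* δ ≡ ε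
    divide B ε B>0 ε>0 = ℚ.1/ B ℚ.* ε
      , subst (ℚ._< ℚ.1/ B ℚ.* ε) (ℚ.*-zeroʳ (ℚ.1/ B)) (ℚ.*-monoʳ-<-pos (ℚ.1/ B) ε>0)
      , trans (sym (ℚ.*-assoc B (ℚ.1/ B) ε))
              (trans (cong (ℚ._* ε) (ℚ.*-inverseʳ B)) (ℚ.*-identityˡ ε))
      where
      instance
        B-pos : ℚ.Positive B
        B-pos = ℚ.positive B>0
        B≢0 : ℚ.NonZero B
        B≢0 = ℚ.pos⇒nonZero B
        1/B-pos : ℚ.Positive (ℚ.1/ B)
        1/B-pos = ℚ.1/pos⇒pos B

    ∣*∣-≤ : ∀ {p q B δ} → 0ℚ ℚ.< B → ∣ p ∣ ℚ.≤ B → ∣ q ∣ ℚ.≤ δ → ∣ p ℚ.* q ∣ ℚ.≤ B ℚ.* δ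
    ∣*∣-≤ {p} {q} {B} {δ} B>0 hp hq = subst (ℚ._≤ B ℚ.* δ) (sym (ℚ.∣p*q∣≡∣p∣*∣q∣ p q))
      (ℚ.≤-trans (ℚ.*-monoʳ-≤-nonNeg ∣ q ∣ {{ℚ.∣-∣-nonNeg q}} hp)
                 (ℚ.*-monoˡ-≤-nonNeg B {{ℚ.nonNegative (ℚ.<⇒≤ B>0)}} hq))

    *-sub : ∀ p q r → p ℚ.* (q ℚ.- r) ≡ p ℚ.* q ℚ.- p ℚ.* r
    *-sub p q r = trans (ℚ.*-distribˡ-+ p q (ℚ.- r)) (cong (p ℚ.* q ℚ.+_) (sym (ℚ.neg-distribʳ-* p r)))

    telescope : ∀ p q r → (p ℚ.- q) ℚ.+ (q ℚ.- r) ≡ p ℚ.- r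
    telescope = solve 3 (λ p q r → (p :- q) :+ (q :- r) := p :- r) refl
      where open +-*-Solver

    *-sub-* : ∀ a b c d → a ℚ.* (c ℚ.- d) ℚ.+ d ℚ.* (a ℚ.- b) ≡ a ℚ.* c ℚ.- b ℚ.* d
    *-sub-* a b c d = trans
      (cong₂ ℚ._+_ (*-sub a c d)
        (trans (*-sub d a b) (cong₂ ℚ._-_ (ℚ.*-comm d a) (ℚ.*-comm d b))))
      (telescope (a ℚ.* c) (a ℚ.* d) (b ℚ.* d))

    *-close : ∀ {a b c d A B δ η ζ} → 0ℚ ℚ.< A → 0ℚ ℚ.< B → A ℚ.* δ ≡ ζ → B ℚ.* η ≡ ζ →
              ∣ a ∣ ℚ.≤ A → ∣ d ∣ ℚ.≤ B → ∣ c ℚ.- d ∣ ℚ.≤ δ → ∣ a ℚ.- b ∣ ℚ.≤ η →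
              ∣ a ℚ.* c ℚ.- b ℚ.* d ∣ ℚ.≤ ζ ℚ.+ ζ
    *-close {a} {b} {c} {d} {A} {B} {δ} {η} A>0 B>0 refl Bη≡ ha hd hcd hab =
      subst (λ z → ∣ z ∣ ℚ.≤ A ℚ.* δ ℚ.+ A ℚ.* δ) (*-sub-* a b c d)
        (ℚ.≤-trans (ℚ.∣p+q∣≤∣p∣+∣q∣ (a ℚ.* (c ℚ.- d)) (d ℚ.* (a ℚ.- b)))
          (ℚ.+-mono-≤ (∣*∣-≤ {a} {c ℚ.- d} {A} {δ} A>0 ha hcd)
            (subst (∣ d ℚ.* (a ℚ.- b) ∣ ℚ.≤_) Bη≡ (∣*∣-≤ {d} {a ℚ.- b} {B} {η} B>0 hd hab))))

    *-cauchy : ∀ {s t} → IsCauchy s → IsCauchy t → IsCauchy (λ n → s n ℚ.* t n)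
    *-cauchy {s} {t} cs ct ε ε>0 = bounds (cauchy⇒bounded cs) (cauchy⇒bounded ct)
      where
      Goal : Set
      Goal = ∃[ N ] ∀ m n → N ℕ.≤ m → N ℕ.≤ n → ∣ s m ℚ.* t m ℚ.- s n ℚ.* t n ∣ ℚ.≤ ε

      bounds : Bounded s → Bounded t → Goal
      bounds (A , A>0 , K , boundA) (B , B>0 , L , boundB) =
        tolerances (divide A (½ ℚ.* ε) A>0 (half>0 ε ε>0)) (divide B (½ ℚ.* ε) B>0 (half>0 ε ε>0))
        where
        tolerances : (Σ[ δ ∈ ℚ ] 0ℚ ℚ.< δ × A ℚ.* δ ≡ ½ ℚ.* ε) →
                     (Σ[ η ∈ ℚ ] 0ℚ ℚ.< η × B ℚ.* η ≡ ½ ℚ.* ε) → Goal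
        tolerances (δ , δ>0 , Aδ≡) (η , η>0 , Bη≡) = N , λ m n hm hn →
          subst (∣ s m ℚ.* t m ℚ.- s n ℚ.* t n ∣ ℚ.≤_) (half+half ε)
            (*-close {s m} {s n} {t m} {t n} {A} {B} {δ} {η} A>0 B>0 Aδ≡ Bη≡
              (boundA m (⊔-≤ˡ (⊔-≤ˡ hm))) (boundB n (⊔-≤ʳ {K} {L} (⊔-≤ˡ hn)))
              (proj₂ (ct δ δ>0) m n (⊔-≤ˡ (N₂≤ hm)) (⊔-≤ˡ (N₂≤ hn)))
              (proj₂ (cs η η>0) m n (⊔-≤ʳ {M₁} {M₂} (N₂≤ hm)) (⊔-≤ʳ {M₁} {M₂} (N₂≤ hn))))
          where
          M₁ M₂ N : ℕ
          M₁ = proj₁ (ct δ δ>0)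
          M₂ = proj₁ (cs η η>0)
          N = (K ℕ.⊔ L) ℕ.⊔ (M₁ ℕ.⊔ M₂)

          N₂≤ : ∀ {n} → N ℕ.≤ n → M₁ ℕ.⊔ M₂ ℕ.≤ n
          N₂≤ = ⊔-≤ʳ {K ℕ.⊔ L} {M₁ ℕ.⊔ M₂}

    const-cauchy : ∀ q → IsCauchy (λ _ → q)
    const-cauchy q ε ε>0 = 0 , λ _ _ _ _ →
      subst (λ z → ∣ z ∣ ℚ.≤ ε) (sym (ℚ.+-inverseʳ q)) (ℚ.<⇒≤ ε>0)

open CauchyLemmas

infixl 6 _+ᵣ_ _-ᵣ_
infixl 7 _*ᵣ_ _⊓ᵣ_
infix  8 -ᵣ_

fromℚ : ℚ → ℝ
fromℚ q = mkℝ (λ _ → q) (const-cauchy q)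

0ᵣ 1ᵣ : ℝ
0ᵣ = fromℚ 0ℚ
1ᵣ = fromℚ 1ℚ

-ᵣ_ : ℝ → ℝ
-ᵣ x   = mkℝ (λ n → ℚ.- seq x n) (neg-cauchy {seq x} (cauchy x))

_+ᵣ_ _-ᵣ_ _*ᵣ_ _⊓ᵣ_ : ℝ → ℝ → ℝ
x +ᵣ y = mkℝ (λ n → seq x n ℚ.+ seq y n) (+-cauchy {seq x} {seq y} (cauchy x) (cauchy y))
x -ᵣ y = x +ᵣ (-ᵣ y)
x *ᵣ y = mkℝ (λ n → seq x n ℚ.* seq y n) (*-cauchy {seq x} {seq y} (cauchy x) (cauchy y))
x ⊓ᵣ y = mkℝ (λ n → seq x n ℚ.⊓ seq y n) (⊓-cauchy {seq x} {seq y} (cauchy x) (cauchy y))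

sumᵣ productᵣ : List ℝ → ℝ
sumᵣ     = foldr _+ᵣ_ 0ᵣ
productᵣ = foldr _*ᵣ_ 1ᵣ

------------------------------------------------------------------------
-- Enumeration of the permutations of Fin k: choose the image j of zero,
-- then a permutation of the remaining elements.

permutations : ∀ k → List (Permutation′ k)
permutations zero    = [ id ]
permutations (suc k) = cartesianProductWith (insert zero) (allFin (suc k)) (permutations k)

private
  length-cartesianProductWith : ∀ {A B C : Set} (f : A → B → C) xs ys →
    length (cartesianProductWith f xs ys) ≡ length xs ℕ.* length ys
  length-cartesianProductWith f []       ys = refl
  length-cartesianProductWith f (x ∷ xs) ys = trans (length-++ (map (f x) ys))
    (cong₂ ℕ._+_ (length-map (f x) ys) (length-cartesianProductWith f xs ys))

-- Together the next two facts say that each permutation is listed exactly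
-- once, up to pointwise equality.

length-permutations : ∀ k → length (permutations k) ≡ k !
length-permutations zero    = refl
length-permutations (suc k) =
  trans (length-cartesianProductWith (insert zero) (allFin (suc k)) (permutations k))
        (cong₂ ℕ._*_ (length-tabulate {n = suc k} (λ i → i)) (length-permutations k))

private
  insert-∈ : ∀ k (j : Fin (suc k)) (ρ : Permutation′ k) →
             ρ ∈ permutations k → insert zero j ρ ∈ permutations (suc k)
  insert-∈ k j ρ ρ∈ = ∈-cartesianProductWith⁺ (insert zero) {allFin (suc k)} {permutations k} {j} {ρ} (∈-allFin j) ρ∈

  insert-≈ : ∀ {k} (π : Permutation′ (suc k)) (ρ : Permutation′ k) →
             ρ ≈ remove zero π → insert zero (π ⟨$⟩ʳ zero) ρ ≈ π
  insert-≈ π ρ h zero    = refl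
  insert-≈ π ρ h (suc i) = trans (cong (punchIn (π ⟨$⟩ʳ zero)) (h i)) (insert-remove zero π (suc i))

permutations-complete : ∀ k (π : Permutation′ k) → Σ[ ρ ∈ Permutation′ k ] ρ ∈ permutations k × ρ ≈ π
permutations-complete zero    π = id , here refl , λ ()
permutations-complete (suc k) π = extend (permutations-complete k (remove zero π))
  where
  extend : (Σ[ ρ ∈ Permutation′ k ] ρ ∈ permutations k × ρ ≈ remove zero π) →
           Σ[ ρ ∈ Permutation′ (suc k) ] ρ ∈ permutations (suc k) × ρ ≈ π
  extend (ρ , ρ∈ , ρ≈) = insert zero (π ⟨$⟩ʳ zero) ρ , insert-∈ k (π ⟨$⟩ʳ zero) ρ ρ∈ , insert-≈ π ρ ρ≈

------------------------------------------------------------------------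
-- The cut density.  Terminals 1 and 2 are the indices zero and suc zero.

record InSimplex {k : ℕ} (x : Fin k → ℝ) : Set where
  field
    nonNegative : ∀ i → 0ᵣ ≤ᵣ x i
    sum≈1       : sumᵣ (map x (allFin k)) ≈ᵣ 1ᵣ

6/11 11/6 : ℝ
6/11 = fromℚ (+ 6 / 11)
11/6 = fromℚ (+ 11 / 6)

F : ℝ → ℝ
F z = (11/6 *ᵣ z) ⊓ᵣ 1ᵣ

-- F′ is discontinuous at 6/11, so constructively it is a function of z
-- together with a decision of z ≤ 6/11.

F′ : (z : ℝ) → Dec (z ≤ᵣ 6/11) → ℝ
F′ z (yes _) = 11/6
F′ z (no  _) = 0ᵣ

uncapturedBefore : ∀ {k} → (Fin k → ℝ) → Permutation′ k → Fin k → ℝ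
uncapturedBefore {k} x σ j =
  productᵣ (map (λ i → 1ᵣ -ᵣ F (x i))
                (filter (λ i → (σ ⟨$⟩ʳ i) Fin.<? (σ ⟨$⟩ʳ j)) (allFin k)))

density : ∀ {n} (x : Fin (2 ℕ.+ n) → ℝ) →
          Dec (x zero ≤ᵣ 6/11) → Dec (x (suc zero) ≤ᵣ 6/11) → ℝ
density {n} x x₁≤? x₂≤? =
  fromℚ ((+ 1 / (k !)) {{k !≢0}}) *ᵣ
  sumᵣ (map (λ σ → F′ (x zero) x₁≤? *ᵣ uncapturedBefore x σ zero
                +ᵣ F′ (x (suc zero)) x₂≤? *ᵣ uncapturedBefore x σ (suc zero))
            (permutations k))
  where k = 2 ℕ.+ n

densityBound : {P Q : Set} → Dec P → Dec Q → ℝ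
densityBound (yes _) (yes _) = fromℚ (+ 2014096 / 1000000)
densityBound (yes _) (no  _) = fromℚ (+ 11 / 12)
densityBound (no  _) _       = fromℚ (+ 11 / 12)

{-# OPTIONS --safe #-}
module Submission where

-- Write uᵢ = F(xᵢ).  A terminal that enters at a uniformly random time t finds
-- terminal i already present with probability t, so the average over orders is
-- d = 11/6 ∫₀¹ (2 − t(u₁ + u₂)) ∏_{i≥3} (1 − tuᵢ) dt.  If x₁ or x₂ exceeds 6/11,
-- or some xᵢ with i ≥ 3 does, a factor 1 − t already gives 11/12, respectively
-- 11/6.  Otherwise Σ uᵢ = 11/6, and with c = Σ_{i≥3} uᵢ the product is at most a
-- quintic T(tc) close to exp(−tc), as (1 − u)T(x) ≤ T(x + u).  What remains is
-- the maximum over c of an explicit polynomial, attained near c = 0.2948.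
--
-- Integrals of polynomials are handled through their moments on [0,1], and real
-- numbers through rational approximations, whose error enters as δ.

open import Defs
open import Data.Fin.Base using (Fin; zero; suc; toℕ; punchIn)
open import Data.Nat.Base as ℕ using (ℕ; zero; suc; _!)
import Data.Nat.Properties as ℕ
open import Data.Product.Base using (Σ-syntax; ∃-syntax; _×_; _,_; proj₁; proj₂)
open import Data.Sum.Base using (_⊎_; inj₁; inj₂)
open import Relation.Binary.PropositionalEquality using (_≡_; refl; sym; trans; cong; cong₂; subst; subst₂; module ≡-Reasoning)
open import Relation.Nullary.Decidable using (Dec; yes; no; does; from-yes)

-- With no integral at hand, a pointwise inequality between polynomials on [0,1] has to be replaced
-- by one between finitely many moments. By Hausdorff's criterion a sequence is the moment sequence
-- of a measure on [0,1] exactly when all integrals of tᵃ(1 - t)ᵇ come out nonnegative. So each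
-- inequality is certified by writing the difference in the products tᵃ(1 - t)ᵇ with nonnegative
-- coefficients. Multiplying the measure by 1 - tu keeps this positivity for u in [0,1], and
-- therefore the factors can pass one at a time from the measure into the argument of T, however
-- many there are.
--
-- The passage from orders to integrals rests on 1 - tu = t(1 - u) + (1 - t): expanding the product
-- gives elementary symmetric functions of the 1 - uᵢ with Beta integrals as weights, and up to
-- factorials these weights count orders.
--
-- The inequality for T is only available up to total 3/2. A larger c is handled by lowering some uᵢ
-- until the total is exactly 3/2, where T alone already leaves room.

-- Rational arithmetic, the embedding of ℕ, finite sums

module RationalArithmetic where

  import Data.Integer.Base as ℤ
  import Data.Integer.Properties as ℤ
  open import Data.Rational.Base
  open import Data.Rational.Properties
  import Data.Rational.Unnormalised.Base as ℚᵘ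
  import Data.Rational.Unnormalised.Properties as ℚᵘ
  open import Data.Rational.Solver using (module +-*-Solver)
  open +-*-Solver

  abstract

    0≤+ : ∀ {p q} → 0ℚ ≤ p → 0ℚ ≤ q → 0ℚ ≤ p + q
    0≤+ = +-mono-≤

    0≤* : ∀ {p q} → 0ℚ ≤ p → 0ℚ ≤ q → 0ℚ ≤ p * q
    0≤* {p} {q} 0≤p 0≤q = nonNegative⁻¹ (p * q)
      {{nonNeg*nonNeg⇒nonNeg p {{nonNegative 0≤p}} q {{nonNegative 0≤q}}}}

    0≤square : ∀ p → 0ℚ ≤ p * p
    0≤square p with ≤-total 0ℚ p
    ... | inj₁ 0≤p = 0≤* 0≤p 0≤p
    ... | inj₂ p≤0 = subst (0ℚ ≤_) (neg*neg p) (0≤* (neg-antimono-≤ p≤0) (neg-antimono-≤ p≤0))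
      where
      neg*neg : ∀ p → - p * - p ≡ p * p
      neg*neg = solve 1 (λ p → :- p :* :- p := p :* p) refl

    ≤-by : ∀ {p q e} → q ≡ p + e → 0ℚ ≤ e → p ≤ q
    ≤-by {p} {q} {e} q≡p+e 0≤e =
      subst₂ _≤_ (+-identityʳ p) (sym q≡p+e) (+-monoʳ-≤ p 0≤e)

    p≤p+ : ∀ p {e} → 0ℚ ≤ e → p ≤ p + e
    p≤p+ p = ≤-by {p} refl

    ≤⇒0≤- : ∀ {p q} → p ≤ q → 0ℚ ≤ q - p
    ≤⇒0≤- {p} {q} p≤q = subst (_≤ q - p) (+-inverseʳ p) (+-monoˡ-≤ (- p) p≤q)

    *-monoˡ : ∀ {r p q} → 0ℚ ≤ r → p ≤ q → r * p ≤ r * q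
    *-monoˡ {r} 0≤r = *-monoˡ-≤-nonNeg r {{nonNegative 0≤r}}

  abstract

    ι : ℕ → ℚ
    ι n = ℤ.+ n / 1

    ι-0 : ι 0 ≡ 0ℚ
    ι-0 = refl

    ι-1 : ι 1 ≡ 1ℚ
    ι-1 = refl

    0≤ι : ∀ n → 0ℚ ≤ ι n
    0≤ι n = nonNegative⁻¹ (ι n) {{normalize-nonNeg n 1}}

    ι-suc : ∀ n → ι (suc n) ≡ 1ℚ + ι n
    ι-suc n = toℚᵘ-injective (begin
      toℚᵘ (ι (suc n))                      ≈⟨ toℚᵘ-fromℚᵘ (ℚᵘ.mkℚᵘ (ℤ.+ suc n) 0) ⟩
      ℚᵘ.mkℚᵘ (ℤ.+ suc n) 0                   ≈⟨ ℚᵘ.*≡* (cong (ℤ._* ℤ.+ 1) (cong ℤ.suc (sym (ℤ.*-identityʳ (ℤ.+ n))))) ⟩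
      ℚᵘ.1ℚᵘ ℚᵘ.+ ℚᵘ.mkℚᵘ (ℤ.+ n) 0           ≈⟨ ℚᵘ.+-cong (ℚᵘ.≃-refl {ℚᵘ.1ℚᵘ}) (toℚᵘ-fromℚᵘ (ℚᵘ.mkℚᵘ (ℤ.+ n) 0)) ⟨
      toℚᵘ 1ℚ ℚᵘ.+ toℚᵘ (ι n)               ≈⟨ toℚᵘ-homo-+ 1ℚ (ι n) ⟨
      toℚᵘ (1ℚ + ι n)                       ∎)
      where open import Relation.Binary.Reasoning.Setoid ℚᵘ.≃-setoid

    ι-+ : ∀ m n → ι (m ℕ.+ n) ≡ ι m + ι n
    ι-+ zero    n = sym (+-identityˡ (ι n))
    ι-+ (suc m) n = begin
      ι (suc (m ℕ.+ n))   ≡⟨ ι-suc (m ℕ.+ n) ⟩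
      1ℚ + ι (m ℕ.+ n)    ≡⟨ cong (1ℚ +_) (ι-+ m n) ⟩
      1ℚ + (ι m + ι n)    ≡⟨ +-assoc 1ℚ (ι m) (ι n) ⟨
      1ℚ + ι m + ι n      ≡⟨ cong (_+ ι n) (ι-suc m) ⟨
      ι (suc m) + ι n     ∎
      where open ≡-Reasoning

    ι-* : ∀ m n → ι (m ℕ.* n) ≡ ι m * ι n
    ι-* zero    n = sym (*-zeroˡ (ι n))
    ι-* (suc m) n = begin
      ι (n ℕ.+ m ℕ.* n)   ≡⟨ ι-+ n (m ℕ.* n) ⟩
      ι n + ι (m ℕ.* n)   ≡⟨ cong (ι n +_) (ι-* m n) ⟩
      ι n + ι m * ι n     ≡⟨ solve 2 (λ a b → b :+ a :* b := (con 1ℚ :+ a) :* b) refl (ι m) (ι n) ⟩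
      (1ℚ + ι m) * ι n    ≡⟨ cong (_* ι n) (ι-suc m) ⟨
      ι (suc m) * ι n     ∎
      where open ≡-Reasoning

    recip-ι : ∀ n .{{_ : ℕ.NonZero n}} → ℤ.+ 1 / n * ι n ≡ 1ℚ
    recip-ι (suc n) = toℚᵘ-injective (begin
      toℚᵘ (ℤ.+ 1 / suc n * ι (suc n))              ≈⟨ toℚᵘ-homo-* (ℤ.+ 1 / suc n) (ι (suc n)) ⟩
      toℚᵘ (ℤ.+ 1 / suc n) ℚᵘ.* toℚᵘ (ι (suc n))    ≈⟨ ℚᵘ.*-cong (toℚᵘ-fromℚᵘ (ℚᵘ.mkℚᵘ (ℤ.+ 1) n)) (toℚᵘ-fromℚᵘ (ℚᵘ.mkℚᵘ (ℤ.+ suc n) 0)) ⟩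
      ℚᵘ.mkℚᵘ (ℤ.+ 1) n ℚᵘ.* ℚᵘ.mkℚᵘ (ℤ.+ suc n) 0    ≈⟨ ℚᵘ.*≡* (trans (ℤ.*-identityʳ _) (cong (λ m → ℤ.+ 1 ℤ.* ℤ.+ m) (sym (ℕ.*-identityʳ (suc n))))) ⟩
      ℚᵘ.1ℚᵘ                                      ∎)
      where open import Relation.Binary.Reasoning.Setoid ℚᵘ.≃-setoid

    recip-ι-* : ∀ n p → ℤ.+ 1 / suc n * (ι (suc n) * p) ≡ p
    recip-ι-* n p = begin
      ℤ.+ 1 / suc n * (ι (suc n) * p) ≡⟨ *-assoc (ℤ.+ 1 / suc n) (ι (suc n)) p ⟨
      ℤ.+ 1 / suc n * ι (suc n) * p   ≡⟨ cong (_* p) (recip-ι (suc n)) ⟩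
      1ℚ * p                          ≡⟨ *-identityˡ p ⟩
      p                               ∎
      where open ≡-Reasoning

    ι-*-cancel-≡ : ∀ n {p q} → ι (suc n) * p ≡ ι (suc n) * q → p ≡ q
    ι-*-cancel-≡ n {p} {q} eq = trans (sym (recip-ι-* n p)) (trans (cong (ℤ.+ 1 / suc n *_) eq) (recip-ι-* n q))

    ι-*-cancel-0≤ : ∀ n {p} → 0ℚ ≤ ι (suc n) * p → 0ℚ ≤ p
    ι-*-cancel-0≤ n {p} 0≤np = subst (0ℚ ≤_) (recip-ι-* n p)
      (0≤* (nonNegative⁻¹ (ℤ.+ 1 / suc n) {{normalize-nonNeg 1 (suc n)}}) 0≤np)

  Sum : ∀ n → (Fin n → ℚ) → ℚ
  Sum zero    f = 0ℚ
  Sum (suc n) f = f zero + Sum n (λ i → f (suc i))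

  0≤Sum : ∀ n f → (∀ i → 0ℚ ≤ f i) → 0ℚ ≤ Sum n f
  0≤Sum zero    f 0≤f = ≤-refl
  0≤Sum (suc n) f 0≤f = 0≤+ (0≤f zero) (0≤Sum n _ (λ i → 0≤f (suc i)))

  Sum-mono : ∀ n {f g} → (∀ i → f i ≤ g i) → Sum n f ≤ Sum n g
  Sum-mono zero    f≤g = ≤-refl
  Sum-mono (suc n) f≤g = +-mono-≤ (f≤g zero) (Sum-mono n (λ i → f≤g (suc i)))

  Sum-cong : ∀ n {f g} → (∀ i → f i ≡ g i) → Sum n f ≡ Sum n g
  Sum-cong zero    f≡g = refl
  Sum-cong (suc n) f≡g = cong₂ _+_ (f≡g zero) (Sum-cong n (λ i → f≡g (suc i)))

  abstract

    Sum-+ : ∀ n f g → Sum n (λ i → f i + g i) ≡ Sum n f + Sum n g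
    Sum-+ zero    f g = refl
    Sum-+ (suc n) f g = trans (cong (f zero + g zero +_) (Sum-+ n _ _))
      (solve 4 (λ a b c d → a :+ b :+ (c :+ d) := a :+ c :+ (b :+ d)) refl (f zero) (g zero) _ _)

    Sum-*ˡ : ∀ n c f → Sum n (λ i → c * f i) ≡ c * Sum n f
    Sum-*ˡ zero    c f = sym (*-zeroʳ c)
    Sum-*ˡ (suc n) c f = trans (cong (c * f zero +_) (Sum-*ˡ n c _)) (sym (*-distribˡ-+ c (f zero) _))

    Sum-last : ∀ n (f : ℕ → ℚ) → Sum (suc n) (λ i → f (toℕ i)) ≡ Sum n (λ i → f (toℕ i)) + f n
    Sum-last zero    f = trans (+-identityʳ (f 0)) (sym (+-identityˡ (f 0)))
    Sum-last (suc n) f = trans (cong (f 0 +_) (Sum-last n (λ j → f (suc j)))) (sym (+-assoc (f 0) _ _))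

-- Moment sequences on [0,1] and the polynomial bound for products

module Moments where

  open RationalArithmetic
  import Data.Integer.Base as ℤ
  open import Data.Rational.Base
  open import Data.Rational.Properties
  open import Data.Rational.Solver using (module +-*-Solver)
  open +-*-Solver

  Unit : ℚ → Set
  Unit u = 0ℚ ≤ u × u ≤ 1ℚ

  infixr 5 _▷_

  -- If μ a = ∫ tᵃ dm for a measure m on [0,1], then u ▷ μ is the moment
  -- sequence of (1 − ut) dm, and Δ b μ a = ∫ tᵃ(1 − t)ᵇ dm.
  _▷_ : ℚ → (ℕ → ℚ) → ℕ → ℚ
  (u ▷ μ) a = μ a - u * μ (suc a)

  Δ : ℕ → (ℕ → ℚ) → ℕ → ℚ
  Δ zero    μ a = μ a
  Δ (suc b) μ a = Δ b μ a - Δ b μ (suc a)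

  CompletelyMonotone : (ℕ → ℚ) → Set
  CompletelyMonotone μ = ∀ b a → 0ℚ ≤ Δ b μ a

  mul : ∀ n → (Fin n → ℚ) → (ℕ → ℚ) → ℕ → ℚ
  mul zero    us μ = μ
  mul (suc n) us μ = us zero ▷ mul n (λ i → us (suc i)) μ

  abstract

    harmonic : ℕ → ℚ
    harmonic a = ℤ.+ 1 / suc a

    0≤harmonic : ∀ a → 0ℚ ≤ harmonic a
    0≤harmonic a = nonNegative⁻¹ (harmonic a) {{normalize-nonNeg 1 (suc a)}}

    ι*harmonic : ∀ a → ι (suc a) * harmonic a ≡ 1ℚ
    ι*harmonic a = trans (*-comm (ι (suc a)) (harmonic a)) (recip-ι (suc a))

  Δ-▷ : ∀ u μ b a → Δ b (u ▷ μ) a ≡ Δ b μ a - u * Δ b μ (suc a)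
  Δ-▷ u μ zero    a = refl
  Δ-▷ u μ (suc b) a = trans (cong₂ _-_ (Δ-▷ u μ b a) (Δ-▷ u μ b (suc a)))
    (solve 4 (λ u p q r → (p :- u :* q) :- (q :- u :* r) := (p :- q) :- u :* (q :- r)) refl
      u (Δ b μ a) (Δ b μ (suc a)) (Δ b μ (suc (suc a))))

  -- Integrated form of 1 - tu = (1 - u) + u(1 - t), which exhibits the new factor as a convex
  -- combination and so preserves positivity.
  Δ-▷-convex : ∀ u μ b a → Δ b (u ▷ μ) a ≡ (1ℚ - u) * Δ b μ a + u * Δ (suc b) μ a
  Δ-▷-convex u μ b a = trans (Δ-▷ u μ b a)
    (solve 3 (λ u p q → p :- u :* q := (con 1ℚ :- u) :* p :+ u :* (p :- q)) refl u (Δ b μ a) (Δ b μ (suc a)))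

  ▷-CM : ∀ {u μ} → Unit u → CompletelyMonotone μ → CompletelyMonotone (u ▷ μ)
  ▷-CM {u} {μ} (0≤u , u≤1) cm b a = subst (0ℚ ≤_) (sym (Δ-▷-convex u μ b a))
    (0≤+ (0≤* (≤⇒0≤- u≤1) (cm b a)) (0≤* 0≤u (cm (suc b) a)))

  -- `Δ b harmonic a` is the Beta integral a! b!/(a + b + 1)!. This identity and `harmonic-Δ` are
  -- its recursions in a and in b. They are proved together: the step in b follows from the ratio in
  -- a by subtraction, and the ratio at `suc b` from the step in b taken at `a` and at `suc a`.
  harmonic-ratio : ∀ b a → ι (2 ℕ.+ (a ℕ.+ b)) * Δ b harmonic (suc a) ≡ ι (suc a) * Δ b harmonic a

  harmonic-Δ : ∀ b a → ι (2 ℕ.+ (a ℕ.+ b)) * Δ (suc b) harmonic a ≡ ι (suc b) * Δ b harmonic a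
  harmonic-Δ b a = begin
    N * (p - q)                       ≡⟨ solve 3 (λ N p q → N :* (p :- q) := N :* p :- N :* q) refl N p q ⟩
    N * p - N * q                     ≡⟨ cong (λ z → N * p - z) (harmonic-ratio b a) ⟩
    N * p - ι (suc a) * p             ≡⟨ cong (λ z → z * p - ι (suc a) * p) N≡ ⟩
    (ι (suc a) + ι (suc b)) * p - ι (suc a) * p ≡⟨ solve 3 (λ x y p → (x :+ y) :* p :- x :* p := y :* p) refl (ι (suc a)) (ι (suc b)) p ⟩
    ι (suc b) * p                     ∎
    where
    open ≡-Reasoning
    N = ι (2 ℕ.+ (a ℕ.+ b))
    p = Δ b harmonic a
    q = Δ b harmonic (suc a)
    N≡ : N ≡ ι (suc a) + ι (suc b)
    N≡ = trans (cong ι (cong suc (sym (ℕ.+-suc a b)))) (ι-+ (suc a) (suc b))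

  harmonic-ratio zero    a = trans (cong (λ m → ι (2 ℕ.+ m) * harmonic (suc a)) (ℕ.+-identityʳ a))
    (trans (ι*harmonic (suc a)) (sym (ι*harmonic a)))
  harmonic-ratio (suc b) a = ι-*-cancel-≡ (suc (a ℕ.+ b)) (begin
    N * (ι (2 ℕ.+ (a ℕ.+ suc b)) * Δ (suc b) harmonic (suc a))
      ≡⟨ cong (λ m → N * (ι (2 ℕ.+ m) * Δ (suc b) harmonic (suc a))) (ℕ.+-suc a b) ⟩
    N * (ι (2 ℕ.+ (suc a ℕ.+ b)) * Δ (suc b) harmonic (suc a))
      ≡⟨ cong (N *_) (harmonic-Δ b (suc a)) ⟩
    N * (ι (suc b) * Δ b harmonic (suc a))
      ≡⟨ swap N (ι (suc b)) _ ⟩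
    ι (suc b) * (N * Δ b harmonic (suc a))
      ≡⟨ cong (ι (suc b) *_) (harmonic-ratio b a) ⟩
    ι (suc b) * (ι (suc a) * Δ b harmonic a)
      ≡⟨ swap (ι (suc b)) (ι (suc a)) _ ⟩
    ι (suc a) * (ι (suc b) * Δ b harmonic a)
      ≡⟨ cong (ι (suc a) *_) (harmonic-Δ b a) ⟨
    ι (suc a) * (N * Δ (suc b) harmonic a)
      ≡⟨ swap (ι (suc a)) N _ ⟩
    N * (ι (suc a) * Δ (suc b) harmonic a) ∎)
    where
    open ≡-Reasoning
    N = ι (2 ℕ.+ (a ℕ.+ b))
    swap : ∀ x y z → x * (y * z) ≡ y * (x * z)
    swap = solve 3 (λ x y z → x :* (y :* z) := y :* (x :* z)) refl

  harmonic-CM : CompletelyMonotone harmonic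
  harmonic-CM zero    a = 0≤harmonic a
  harmonic-CM (suc b) a = ι-*-cancel-0≤ (suc (a ℕ.+ b))
    (subst (0ℚ ≤_) (sym (harmonic-Δ b a)) (0≤* (0≤ι (suc b)) (harmonic-CM b a)))

  mul-CM : ∀ n {us μ} → (∀ i → Unit (us i)) → CompletelyMonotone μ → CompletelyMonotone (mul n us μ)
  mul-CM zero    unit cm = cm
  mul-CM (suc n) unit cm = ▷-CM (unit zero) (mul-CM n (λ i → unit (suc i)) cm)

  -- Factors commute. This lets a distinguished factor be absorbed into the base measure, so that
  -- results about `mul` apply to the remaining ones.
  mul-▷ : ∀ n us y μ a → mul n us (y ▷ μ) a ≡ (y ▷ mul n us μ) a
  mul-▷ zero    us y μ a = refl
  mul-▷ (suc n) us y μ a = trans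
    (cong₂ (λ p q → p - us zero * q) (mul-▷ n _ y μ a) (mul-▷ n _ y μ (suc a)))
    (solve 5 (λ u y p q r → (p :- y :* q) :- u :* (q :- y :* r) := (p :- u :* q) :- y :* (q :- u :* r)) refl
      (us zero) y (A a) (A (suc a)) (A (suc (suc a))))
    where A = mul n (λ i → us (suc i)) μ

  ▷-≤ : ∀ {u μ} → CompletelyMonotone μ → 0ℚ ≤ u → ∀ a → (u ▷ μ) a ≤ μ a
  ▷-≤ {u} {μ} cm 0≤u a = ≤-by
    (solve 3 (λ u p q → p := (p :- u :* q) :+ u :* q) refl u (μ a) (μ (suc a)))
    (0≤* 0≤u (cm 0 (suc a)))

  mul-≤ : ∀ n {us μ} → (∀ i → Unit (us i)) → CompletelyMonotone μ → ∀ a → mul n us μ a ≤ μ a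
  mul-≤ zero    unit cm a = ≤-refl
  mul-≤ (suc n) unit cm a = ≤-trans
    (▷-≤ (mul-CM n (λ i → unit (suc i)) cm) (proj₁ (unit zero)) a)
    (mul-≤ n (λ i → unit (suc i)) cm a)

  -- The induction needs every `b`: splitting off a factor with `Δ-▷-convex` uses the hypothesis at
  -- `b` and at `suc b`. Afterwards the coefficient `u` itself is lowered to `u′`.
  mul-antitone : ∀ n {us us′ μ} → (∀ i → Unit (us i)) → (∀ i → 0ℚ ≤ us′ i × us′ i ≤ us i) →
                 CompletelyMonotone μ → ∀ b a → Δ b (mul n us μ) a ≤ Δ b (mul n us′ μ) a
  mul-antitone zero    unit below cm b a = ≤-refl
  mul-antitone (suc n) {us} {us′} {μ} unit below cm b a = begin
    Δ b (u ▷ A) a                               ≡⟨ Δ-▷-convex u A b a ⟩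
    (1ℚ - u) * Δ b A a + u * Δ (suc b) A a      ≤⟨ +-mono-≤ (*-monoˡ (≤⇒0≤- u≤1) (IH b a)) (*-monoˡ 0≤u (IH (suc b) a)) ⟩
    (1ℚ - u) * Δ b A′ a + u * Δ (suc b) A′ a    ≤⟨ ≤-by (solve 4 (λ u v p q → p :- v :* q := (con 1ℚ :- u) :* p :+ u :* (p :- q) :+ (u :- v) :* q) refl
                                                            u u′ (Δ b A′ a) (Δ b A′ (suc a)))
                                                       (0≤* (≤⇒0≤- u′≤u) (A′-CM b (suc a))) ⟩
    Δ b A′ a - u′ * Δ b A′ (suc a)              ≡⟨ Δ-▷ u′ A′ b a ⟨
    Δ b (u′ ▷ A′) a                             ∎
    where
    open ≤-Reasoning
    u = us zero
    u′ = us′ zero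
    0≤u = proj₁ (unit zero)
    u≤1 = proj₂ (unit zero)
    u′≤u = proj₂ (below zero)
    A = mul n (λ i → us (suc i)) μ
    A′ = mul n (λ i → us′ (suc i)) μ
    IH = mul-antitone n (λ i → unit (suc i)) (λ i → below (suc i)) cm
    A′-CM : CompletelyMonotone A′
    A′-CM = mul-CM n (λ i → proj₁ (below (suc i)) , ≤-trans (proj₂ (below (suc i))) (proj₂ (unit (suc i)))) cm

  mul-≤-▷ : ∀ n {us μ} → (∀ i → Unit (us i)) → CompletelyMonotone μ →
            ∀ i a → mul n us μ a ≤ (us i ▷ μ) a
  mul-≤-▷ (suc n) {us} {μ} unit cm zero    a = subst (_≤ (us zero ▷ μ) a) (mul-▷ n _ (us zero) μ a)
    (mul-≤ n (λ i → unit (suc i)) (▷-CM (unit zero) cm) a)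
  mul-≤-▷ (suc n) unit cm (suc i) a = ≤-trans
    (▷-≤ (mul-CM n (λ i → unit (suc i)) cm) (proj₁ (unit zero)) a)
    (mul-≤-▷ n (λ i → unit (suc i)) cm i a)

  -- Q μ x is the integral of 1 − tx + (tx)²/2 − (tx)³/6 + (tx)⁴/24 − (tx)⁵/156.
  -- The Taylor coefficient 1/120 is lowered to 1/156 so that the polynomial stays
  -- above the product of the factors 1 − tu as long as Σ u ≤ 3/2; without a
  -- quintic term the resulting bound would exceed 2.014096.
  quintic : (x m₀ m₁ m₂ m₃ m₄ m₅ : ℚ) → ℚ
  quintic x m₀ m₁ m₂ m₃ m₄ m₅ = m₀ - x * m₁ + ½ * (x * x) * m₂ - ℤ.+ 1 / 6 * (x * x * x) * m₃
    + ℤ.+ 1 / 24 * (x * x * x * x) * m₄ - ℤ.+ 1 / 156 * (x * x * x * x * x) * m₅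

  quinticₚ : ∀ {n} (x m₀ m₁ m₂ m₃ m₄ m₅ : Polynomial n) → Polynomial n
  quinticₚ x m₀ m₁ m₂ m₃ m₄ m₅ = m₀ :- x :* m₁ :+ con ½ :* (x :* x) :* m₂
    :- con (ℤ.+ 1 / 6) :* (x :* x :* x) :* m₃ :+ con (ℤ.+ 1 / 24) :* (x :* x :* x :* x) :* m₄
    :- con (ℤ.+ 1 / 156) :* (x :* x :* x :* x :* x) :* m₅

  Q : (ℕ → ℚ) → ℚ → ℚ
  Q μ x = quintic x (μ 0) (μ 1) (μ 2) (μ 3) (μ 4) (μ 5)

  Q-0 : ∀ μ → Q μ 0ℚ ≡ μ 0
  Q-0 μ = solve 6 (λ m₀ m₁ m₂ m₃ m₄ m₅ → quinticₚ (con 0ℚ) m₀ m₁ m₂ m₃ m₄ m₅ := m₀) refl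
    (μ 0) (μ 1) (μ 2) (μ 3) (μ 4) (μ 5)

  -- The last two Bernstein coefficients, times the binomials 3 and 1, of the cubic
  -- 1/2 − t(x/2 + u/6) + t²(x²/4 + xu/6 + u²/24) − t³(10x³ + 10x²u + 5xu² + u³)/156.
  b₂ b₃ : ℚ → ℚ → ℚ
  b₂ x u = ℤ.+ 3 / 2 - ℤ.+ 2 / 1 * (½ * x + ℤ.+ 1 / 6 * u)
    + (ℤ.+ 1 / 4 * (x * x) + ℤ.+ 1 / 6 * (x * u) + ℤ.+ 1 / 24 * (u * u))
  b₃ x u = ½ - ½ * x - ℤ.+ 1 / 6 * u + ℤ.+ 1 / 4 * (x * x) + ℤ.+ 1 / 6 * (x * u) + ℤ.+ 1 / 24 * (u * u)
    - ℤ.+ 1 / 156 * (ℤ.+ 10 / 1 * (x * x * x) + ℤ.+ 10 / 1 * (x * x * u) + ℤ.+ 5 / 1 * (x * u * u) + u * u * u)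

  b₂ₚ b₃ₚ : ∀ {n} → Polynomial n → Polynomial n → Polynomial n
  b₂ₚ x u = con (ℤ.+ 3 / 2) :- con (ℤ.+ 2 / 1) :* (con ½ :* x :+ con (ℤ.+ 1 / 6) :* u)
    :+ (con (ℤ.+ 1 / 4) :* (x :* x) :+ con (ℤ.+ 1 / 6) :* (x :* u) :+ con (ℤ.+ 1 / 24) :* (u :* u))
  b₃ₚ x u = con ½ :- con ½ :* x :- con (ℤ.+ 1 / 6) :* u
    :+ con (ℤ.+ 1 / 4) :* (x :* x) :+ con (ℤ.+ 1 / 6) :* (x :* u) :+ con (ℤ.+ 1 / 24) :* (u :* u)
    :- con (ℤ.+ 1 / 156) :* (con (ℤ.+ 10 / 1) :* (x :* x :* x) :+ con (ℤ.+ 10 / 1) :* (x :* x :* u)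
                             :+ con (ℤ.+ 5 / 1) :* (x :* u :* u) :+ u :* u :* u)

  abstract

    0≤b₂ : ∀ {x u} → 0ℚ ≤ x → 0ℚ ≤ u → x + u ≤ ℤ.+ 3 / 2 → 0ℚ ≤ b₂ x u
    0≤b₂ {x} {u} 0≤x 0≤u x+u≤ = subst (0ℚ ≤_) (sym (eq x u))
      (0≤+ (0≤+ (≤⇒0≤- x+u≤) (0≤* (from-yes (0ℚ ≤? ℤ.+ 2 / 3)) 0≤u))
        (0≤+ (0≤+ (0≤* (from-yes (0ℚ ≤? ℤ.+ 1 / 4)) (0≤* 0≤x 0≤x))
                  (0≤* (from-yes (0ℚ ≤? ℤ.+ 1 / 6)) (0≤* 0≤x 0≤u)))
             (0≤* (from-yes (0ℚ ≤? ℤ.+ 1 / 24)) (0≤* 0≤u 0≤u))))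
      where
      eq : ∀ x u → b₂ x u ≡ (ℤ.+ 3 / 2 - (x + u) + ℤ.+ 2 / 3 * u)
        + (ℤ.+ 1 / 4 * (x * x) + ℤ.+ 1 / 6 * (x * u) + ℤ.+ 1 / 24 * (u * u))
      eq = solve 2 (λ x u → b₂ₚ x u
        := (con (ℤ.+ 3 / 2) :- (x :+ u) :+ con (ℤ.+ 2 / 3) :* u)
           :+ (con (ℤ.+ 1 / 4) :* (x :* x) :+ con (ℤ.+ 1 / 6) :* (x :* u) :+ con (ℤ.+ 1 / 24) :* (u :* u))) refl

    0≤b₃ : ∀ {x u} → 0ℚ ≤ x → 0ℚ ≤ u → x + u ≤ ℤ.+ 3 / 2 → 0ℚ ≤ b₃ x u
    0≤b₃ {x} {u} 0≤x 0≤u x+u≤ = subst (0ℚ ≤_) (sym (eq x u))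
      (0≤+ (0≤+ (0≤+ (0≤+ (0≤+ (0≤+
        (from-yes (0ℚ ≤? ℤ.+ 12 / 208))
        (0≤* (from-yes (0ℚ ≤? ℤ.+ 5 / 312)) (0≤+ 0≤u 0≤v)))
        (0≤* (from-yes (0ℚ ≤? ℤ.+ 2 / 13)) (0≤square (x - 1ℚ))))
        (0≤* (from-yes (0ℚ ≤? ℤ.+ 55 / 312)) 0≤v))
        (0≤* (from-yes (0ℚ ≤? ℤ.+ 1 / 156)) (0≤* 0≤u 0≤v)))
        (0≤* (from-yes (0ℚ ≤? ℤ.+ 27 / 156)) (0≤* 0≤x 0≤u)))
        (0≤* (from-yes (0ℚ ≤? ℤ.+ 1 / 156)) (0≤+ (0≤+
          (0≤* (from-yes (0ℚ ≤? ℤ.+ 10 / 1)) (0≤* (0≤* 0≤x 0≤x) 0≤v))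
          (0≤* (from-yes (0ℚ ≤? ℤ.+ 5 / 1)) (0≤* (0≤* 0≤u 0≤u) 0≤v)))
          (0≤* (from-yes (0ℚ ≤? ℤ.+ 4 / 1)) (0≤* (0≤* 0≤u 0≤u) 0≤u)))))
      where
      0≤v : 0ℚ ≤ ℤ.+ 3 / 2 - (x + u)
      0≤v = ≤⇒0≤- x+u≤
      -- With v = 3/2 - (x + u), the cubic part -10x³ - 10x²u - 5xu² - u³ equals -(10x² + 5u²)(3/2 -
      -- v) + 4u³, which leaves nonnegative cubics and a quadratic. There x² has coefficient 1/4 -
      -- 15/156 = 2/13, which gives the square around 1; the small negative u² is absorbed by uv.
      eq : ∀ x u → b₃ x u ≡ let v = ℤ.+ 3 / 2 - (x + u) in
        ℤ.+ 12 / 208 + ℤ.+ 5 / 312 * (u + v) + ℤ.+ 2 / 13 * ((x - 1ℚ) * (x - 1ℚ)) + ℤ.+ 55 / 312 * v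
        + ℤ.+ 1 / 156 * (u * v) + ℤ.+ 27 / 156 * (x * u)
        + ℤ.+ 1 / 156 * (ℤ.+ 10 / 1 * (x * x * v) + ℤ.+ 5 / 1 * (u * u * v) + ℤ.+ 4 / 1 * (u * u * u))
      eq = solve 2 (λ x u → let v = con (ℤ.+ 3 / 2) :- (x :+ u) in
        b₃ₚ x u
        := con (ℤ.+ 12 / 208) :+ con (ℤ.+ 5 / 312) :* (u :+ v) :+ con (ℤ.+ 2 / 13) :* ((x :- con 1ℚ) :* (x :- con 1ℚ))
        :+ con (ℤ.+ 55 / 312) :* v :+ con (ℤ.+ 1 / 156) :* (u :* v) :+ con (ℤ.+ 27 / 156) :* (x :* u)
        :+ con (ℤ.+ 1 / 156) :* (con (ℤ.+ 10 / 1) :* (x :* x :* v) :+ con (ℤ.+ 5 / 1) :* (u :* u :* v)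
                                 :+ con (ℤ.+ 4 / 1) :* (u :* u :* u))) refl

    -- For the quintic T, consider T(t(x + u)) - (1 - tu)T(tx). Its part linear in u is ux⁴t⁵(3/2 -
    -- tx)/156, because 1/24 - 5/156 = (3/2)/156; thus 1/156 is the largest quintic coefficient that
    -- keeps this part nonnegative up to x = 3/2. The rest is u²t² times a cubic in t with
    -- nonnegative Bernstein coefficients, and these are paired with `cm 3 2`, `cm 2 3`, `cm 1 4`
    -- and `cm 0 5`.
    Q-▷-≤ : ∀ {u x μ} → Unit u → 0ℚ ≤ x → x + u ≤ ℤ.+ 3 / 2 → CompletelyMonotone μ →
            Q (u ▷ μ) x ≤ Q μ (x + u)
    Q-▷-≤ {u} {x} {μ} (0≤u , u≤1) 0≤x x+u≤ cm =
      ≤-by (eq x u (μ 0) (μ 1) (μ 2) (μ 3) (μ 4) (μ 5) (μ 6))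
        (0≤+ (0≤* (0≤* (from-yes (0ℚ ≤? ℤ.+ 1 / 156)) (0≤* 0≤u (0≤* (0≤* (0≤* 0≤x 0≤x) 0≤x) 0≤x)))
                  (0≤+ (0≤* (≤⇒0≤- x≤) (cm 0 5)) (0≤* 0≤x (cm 1 5))))
             (0≤* (0≤* 0≤u 0≤u)
               (0≤+ (0≤+ (0≤+ (0≤* (from-yes (0ℚ ≤? ½)) (cm 3 2)) (0≤* (≤⇒0≤- half≤) (cm 2 3)))
                         (0≤* (0≤b₂ 0≤x 0≤u x+u≤) (cm 1 4)))
                    (0≤* (0≤b₃ 0≤x 0≤u x+u≤) (cm 0 5)))))
      where
      x≤ : x ≤ ℤ.+ 3 / 2
      x≤ = ≤-trans (p≤p+ x 0≤u) x+u≤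
      half≤ : ½ * x + ℤ.+ 1 / 6 * u ≤ ℤ.+ 3 / 2
      half≤ = ≤-trans (≤-by (solve 2 (λ x u → x :+ u := con ½ :* x :+ con (ℤ.+ 1 / 6) :* u
                                                 :+ (con ½ :* x :+ con (ℤ.+ 5 / 6) :* u)) refl x u)
                            (0≤+ (0≤* (from-yes (0ℚ ≤? ½)) 0≤x) (0≤* (from-yes (0ℚ ≤? ℤ.+ 5 / 6)) 0≤u)))
                      x+u≤
      eq : ∀ x u m₀ m₁ m₂ m₃ m₄ m₅ m₆ → quintic (x + u) m₀ m₁ m₂ m₃ m₄ m₅
        ≡ quintic x (m₀ - u * m₁) (m₁ - u * m₂) (m₂ - u * m₃) (m₃ - u * m₄) (m₄ - u * m₅) (m₅ - u * m₆)
        + (ℤ.+ 1 / 156 * (u * (x * x * x * x)) * ((ℤ.+ 3 / 2 - x) * m₅ + x * (m₅ - m₆))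
        + u * u * (½ * (m₂ - m₃ - (m₃ - m₄) - (m₃ - m₄ - (m₄ - m₅)))
                   + (ℤ.+ 3 / 2 - (½ * x + ℤ.+ 1 / 6 * u)) * (m₃ - m₄ - (m₄ - m₅))
                   + b₂ x u * (m₄ - m₅)
                   + b₃ x u * m₅))
      eq = solve 9 (λ x u m₀ m₁ m₂ m₃ m₄ m₅ m₆ →
        quinticₚ (x :+ u) m₀ m₁ m₂ m₃ m₄ m₅
        := quinticₚ x (m₀ :- u :* m₁) (m₁ :- u :* m₂) (m₂ :- u :* m₃) (m₃ :- u :* m₄) (m₄ :- u :* m₅) (m₅ :- u :* m₆)
        :+ (con (ℤ.+ 1 / 156) :* (u :* (x :* x :* x :* x)) :* ((con (ℤ.+ 3 / 2) :- x) :* m₅ :+ x :* (m₅ :- m₆))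
        :+ u :* u :* (con ½ :* (m₂ :- m₃ :- (m₃ :- m₄) :- (m₃ :- m₄ :- (m₄ :- m₅)))
             :+ (con (ℤ.+ 3 / 2) :- (con ½ :* x :+ con (ℤ.+ 1 / 6) :* u)) :* (m₃ :- m₄ :- (m₄ :- m₅))
             :+ b₂ₚ x u :* (m₄ :- m₅)
             :+ b₃ₚ x u :* m₅))) refl

  -- Each use of `Q-▷-≤` removes one factor from the measure and adds its `u` to the argument.
  -- Started at 0, where `Q` is the plain integral, this bounds the product by a quantity that
  -- depends on the sum alone.
  Q-mul-≤ : ∀ n {us μ x} → (∀ i → Unit (us i)) → 0ℚ ≤ x → x + Sum n us ≤ ℤ.+ 3 / 2 →
            CompletelyMonotone μ → Q (mul n us μ) x ≤ Q μ (x + Sum n us)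
  Q-mul-≤ zero    {us} {μ} {x} unit 0≤x x+s≤ cm = ≤-reflexive (cong (Q μ) (sym (+-identityʳ x)))
  Q-mul-≤ (suc n) {us} {μ} {x} unit 0≤x x+s≤ cm = begin
    Q (us zero ▷ A) x            ≤⟨ Q-▷-≤ (unit zero) 0≤x x+u≤ (mul-CM n (λ i → unit (suc i)) cm) ⟩
    Q A (x + us zero)            ≤⟨ Q-mul-≤ n (λ i → unit (suc i)) (0≤+ 0≤x (proj₁ (unit zero))) (subst (_≤ ℤ.+ 3 / 2) (sym assoc) x+s≤) cm ⟩
    Q μ (x + us zero + S)        ≡⟨ cong (Q μ) assoc ⟩
    Q μ (x + (us zero + S))      ∎
    where
    open ≤-Reasoning
    A = mul n (λ i → us (suc i)) μ
    S = Sum n (λ i → us (suc i))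
    assoc : x + us zero + S ≡ x + (us zero + S)
    assoc = +-assoc x (us zero) S
    x+u≤ : x + us zero ≤ ℤ.+ 3 / 2
    x+u≤ = ≤-trans (≤-by (sym assoc) (0≤Sum n _ (λ i → proj₁ (unit (suc i))))) x+s≤

  -- Greedy: entries are kept from the front until `r` is used up, and the rest become 0.
  shrink-to-sum : ∀ n us r → (∀ i → 0ℚ ≤ us i) → 0ℚ ≤ r → r ≤ Sum n us →
                  Σ[ us′ ∈ (Fin n → ℚ) ] (∀ i → 0ℚ ≤ us′ i × us′ i ≤ us i) × Sum n us′ ≡ r
  shrink-to-sum zero    us r 0≤us 0≤r r≤0 = us , (λ ()) , ≤-antisym 0≤r r≤0
  shrink-to-sum (suc n) us r 0≤us 0≤r r≤s with ≤-total r (us zero)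
  ... | inj₁ r≤u = extend (shrink-to-sum n (λ i → us (suc i)) 0ℚ (λ i → 0≤us (suc i)) ≤-refl (0≤Sum n _ (λ i → 0≤us (suc i))))
    where
    extend : _ → _
    extend (us′ , below , sum≡) = (λ { zero → r ; (suc i) → us′ i })
      , (λ { zero → 0≤r , r≤u ; (suc i) → below i })
      , trans (cong (r +_) sum≡) (+-identityʳ r)
  ... | inj₂ u≤r = extend (shrink-to-sum n (λ i → us (suc i)) (r - us zero) (λ i → 0≤us (suc i)) (≤⇒0≤- u≤r) r-u≤)
    where
    r-u≤ : r - us zero ≤ Sum n (λ i → us (suc i))
    r-u≤ = subst (r - us zero ≤_) (solve 2 (λ u s → u :+ s :- u := s) refl (us zero) (Sum n (λ i → us (suc i))))
      (+-monoˡ-≤ (- us zero) r≤s)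
    extend : _ → _
    extend (us′ , below , sum≡) = (λ { zero → us zero ; (suc i) → us′ i })
      , (λ { zero → 0≤us zero , ≤-refl ; (suc i) → below i })
      , trans (cong (us zero +_) sum≡) (solve 2 (λ u r → u :+ (r :- u) := r) refl (us zero) r)

  abstract

    -- 2.014096 divided by 11/3, the factor in front of the integral once 2 - t(u₁ + u₂) is written
    -- as 2(1 - ty) with y the mean of u₁ and u₂.
    bound : ℚ
    bound = ℤ.+ 1510572 / 2750000

    11/3*bound : ℤ.+ 11 / 3 * bound ≡ ℤ.+ 2014096 / 1000000
    11/3*bound = refl

    ½≤bound : ½ ≤ bound
    ½≤bound = from-yes (½ ≤? ℤ.+ 1510572 / 2750000)

    -- 314/1065 approximates the maximiser c of the left-hand side to within
    -- 10⁻⁶; the quartic factor and the linear remainder are what division by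
    -- (c − 314/1065)² leaves.
    Q-harmonic-≤ : ∀ {c} → 0ℚ ≤ c → c ≤ ℤ.+ 3 / 2 → Q ((ℤ.+ 11 / 12 - ½ * c) ▷ harmonic) c ≤ bound
    Q-harmonic-≤ {c} 0≤c c≤ = ≤-by (eq c)
      (0≤* (from-yes (0ℚ ≤? ½))
        (0≤+ (0≤+ (0≤* (0≤square (c - ℤ.+ 314 / 1065)) 0≤quartic)
                  (0≤* (from-yes (0ℚ ≤? ℤ.+ 6204481159 / 71244506497612500)) 0≤c))
             (from-yes (0ℚ ≤? ℤ.+ 162016453165601 / 1460601438834178265625))))
      where
      quartic : ℚ → ℚ
      quartic c = ℤ.+ 65782249005289 / 374619001302000 - ℤ.+ 2943926501 / 33822589500 * c
        + ℤ.+ 85253563 / 3302863200 * (c * c) - ℤ.+ 9221 / 1550640 * (c * c * c) + ℤ.+ 1 / 1092 * (c * c * c * c)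
      quarticₚ : ∀ {n} → Polynomial n → Polynomial n
      quarticₚ c = con (ℤ.+ 65782249005289 / 374619001302000) :- con (ℤ.+ 2943926501 / 33822589500) :* c
        :+ con (ℤ.+ 85253563 / 3302863200) :* (c :* c) :- con (ℤ.+ 9221 / 1550640) :* (c :* c :* c)
        :+ con (ℤ.+ 1 / 1092) :* (c :* c :* c :* c)
      eq : ∀ c → bound ≡ Q ((ℤ.+ 11 / 12 - ½ * c) ▷ harmonic) c
        + ½ * ((c - ℤ.+ 314 / 1065) * (c - ℤ.+ 314 / 1065) * quartic c
               + ℤ.+ 6204481159 / 71244506497612500 * c + ℤ.+ 162016453165601 / 1460601438834178265625)
      eq = solve 1 (λ c → let y = con (ℤ.+ 11 / 12) :- con ½ :* c in
        con bound := quinticₚ c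
          (con (ℤ.+ 1 / 1) :- y :* con (ℤ.+ 1 / 2)) (con (ℤ.+ 1 / 2) :- y :* con (ℤ.+ 1 / 3))
          (con (ℤ.+ 1 / 3) :- y :* con (ℤ.+ 1 / 4)) (con (ℤ.+ 1 / 4) :- y :* con (ℤ.+ 1 / 5))
          (con (ℤ.+ 1 / 5) :- y :* con (ℤ.+ 1 / 6)) (con (ℤ.+ 1 / 6) :- y :* con (ℤ.+ 1 / 7))
        :+ con ½ :* ((c :- con (ℤ.+ 314 / 1065)) :* (c :- con (ℤ.+ 314 / 1065)) :* quarticₚ c
               :+ con (ℤ.+ 6204481159 / 71244506497612500) :* c :+ con (ℤ.+ 162016453165601 / 1460601438834178265625))) refl
      -- The negative odd coefficients are compared with the even ones just below them, using c ≤
      -- 3/2.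
      0≤quartic : 0ℚ ≤ quartic c
      0≤quartic = subst (0ℚ ≤_) (sym (split c))
        (0≤+ (0≤+ (0≤+ (0≤+
          (from-yes (0ℚ ≤? rest₀))
          (0≤* (from-yes (0ℚ ≤? ℤ.+ 2943926501 / 33822589500)) (≤⇒0≤- c≤)))
          (0≤* (from-yes (0ℚ ≤? rest₂)) (0≤* 0≤c 0≤c)))
          (0≤* (from-yes (0ℚ ≤? ℤ.+ 9221 / 1550640)) (0≤* (0≤* 0≤c 0≤c) (≤⇒0≤- c≤))))
          (0≤* (from-yes (0ℚ ≤? ℤ.+ 1 / 1092)) (0≤* (0≤* (0≤* 0≤c 0≤c) 0≤c) 0≤c)))
        where
        rest₀ rest₂ : ℚ
        rest₀ = ℤ.+ 65782249005289 / 374619001302000 - ℤ.+ 2943926501 / 33822589500 * (ℤ.+ 3 / 2)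
        rest₂ = ℤ.+ 85253563 / 3302863200 - ℤ.+ 9221 / 1550640 * (ℤ.+ 3 / 2)
        split : ∀ c → quartic c ≡ rest₀ + ℤ.+ 2943926501 / 33822589500 * (ℤ.+ 3 / 2 - c) + rest₂ * (c * c)
          + ℤ.+ 9221 / 1550640 * (c * c * (ℤ.+ 3 / 2 - c)) + ℤ.+ 1 / 1092 * (c * c * c * c)
        split = solve 1 (λ c → quarticₚ c :=
          con rest₀ :+ con (ℤ.+ 2943926501 / 33822589500) :* (con (ℤ.+ 3 / 2) :- c) :+ con rest₂ :* (c :* c)
          :+ con (ℤ.+ 9221 / 1550640) :* (c :* c :* (con (ℤ.+ 3 / 2) :- c)) :+ con (ℤ.+ 1 / 1092) :* (c :* c :* c :* c)) refl

    Q-harmonic-3/2 : Q harmonic (ℤ.+ 3 / 2) ≤ bound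
    Q-harmonic-3/2 = from-yes (quintic (ℤ.+ 3 / 2) 1ℚ ½ (ℤ.+ 1 / 3) (ℤ.+ 1 / 4) (ℤ.+ 1 / 5) (ℤ.+ 1 / 6) ≤? bound)

    harmonic-0 : harmonic 0 ≡ 1ℚ
    harmonic-0 = refl

    harmonic-1 : harmonic 1 ≡ ½
    harmonic-1 = refl

  ▷-mul-harmonic-≤ : ∀ n {us u} → (∀ i → Unit (us i)) → Unit u → (u ▷ mul n us harmonic) 0 ≤ 1ℚ - u * ½
  ▷-mul-harmonic-≤ n {us} {u} unit unit-u = subst₂ _≤_
    (mul-▷ n us u harmonic 0) (cong₂ (λ p q → p - u * q) harmonic-0 harmonic-1)
    (mul-≤ n unit (▷-CM unit-u harmonic-CM) 0)

  mul-harmonic-0-≤-½ : ∀ n {us} → (∀ i → Unit (us i)) → ∀ i → us i ≡ 1ℚ → mul n us harmonic 0 ≤ ½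
  mul-harmonic-0-≤-½ n {us} unit i us-i≡1 = ≤-trans (mul-≤-▷ n unit harmonic-CM i 0)
    (≤-reflexive (trans (cong₂ (λ p q → p - us i * q) harmonic-0 harmonic-1) (cong (λ u → 1ℚ - u * ½) us-i≡1)))

  -- 11/12 - c/2 is the mean of u₁ and u₂ when the total is 11/6. For c in [0, 3/2] it lies in
  -- [1/6, 11/12], so `y ▷ harmonic` is again completely monotone and may serve as the base measure
  -- for `Q-mul-≤`.
  balanced-bound : ∀ n {us} → (∀ i → Unit (us i)) → Sum n us ≤ ℤ.+ 3 / 2 →
                   ((ℤ.+ 11 / 12 - ½ * Sum n us) ▷ mul n us harmonic) 0 ≤ bound
  balanced-bound n {us} unit c≤ = begin
    (y ▷ mul n us harmonic) 0              ≡⟨ mul-▷ n us y harmonic 0 ⟨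
    mul n us (y ▷ harmonic) 0              ≡⟨ Q-0 (mul n us (y ▷ harmonic)) ⟨
    Q (mul n us (y ▷ harmonic)) 0ℚ         ≤⟨ Q-mul-≤ n unit ≤-refl (subst (_≤ ℤ.+ 3 / 2) (sym (+-identityˡ c)) c≤) (▷-CM unit-y harmonic-CM) ⟩
    Q (y ▷ harmonic) (0ℚ + c)              ≡⟨ cong (Q (y ▷ harmonic)) (+-identityˡ c) ⟩
    Q (y ▷ harmonic) c                     ≤⟨ Q-harmonic-≤ 0≤c c≤ ⟩
    bound                                  ∎
    where
    open ≤-Reasoning
    c y : ℚ
    c = Sum n us
    y = ℤ.+ 11 / 12 - ½ * c
    0≤c : 0ℚ ≤ c
    0≤c = 0≤Sum n us (λ i → proj₁ (unit i))
    unit-y : Unit y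
    unit-y = subst (0ℚ ≤_) (solve 1 (λ c → con (ℤ.+ 1 / 6) :+ con ½ :* (con (ℤ.+ 3 / 2) :- c) := con (ℤ.+ 11 / 12) :- con ½ :* c) refl c)
               (0≤+ (from-yes (0ℚ ≤? ℤ.+ 1 / 6)) (0≤* (from-yes (0ℚ ≤? ½)) (≤⇒0≤- c≤)))
           , ≤-by (solve 1 (λ c → con 1ℚ := con (ℤ.+ 11 / 12) :- con ½ :* c :+ (con (ℤ.+ 1 / 12) :+ con ½ :* c)) refl c)
               (0≤+ (from-yes (0ℚ ≤? ℤ.+ 1 / 12)) (0≤* (from-yes (0ℚ ≤? ½)) 0≤c))

  large-sum-bound : ∀ n {us} → (∀ i → Unit (us i)) → ℤ.+ 3 / 2 ≤ Sum n us → mul n us harmonic 0 ≤ bound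
  large-sum-bound n {us} unit ≤c =
    shrunk (shrink-to-sum n us (ℤ.+ 3 / 2) (λ i → proj₁ (unit i)) (from-yes (0ℚ ≤? ℤ.+ 3 / 2)) ≤c)
    where
    open ≤-Reasoning
    shrunk : (Σ[ us′ ∈ (Fin n → ℚ) ] (∀ i → 0ℚ ≤ us′ i × us′ i ≤ us i) × Sum n us′ ≡ ℤ.+ 3 / 2) →
             mul n us harmonic 0 ≤ bound
    shrunk (us′ , below , sum≡) = begin
      mul n us harmonic 0                     ≤⟨ mul-antitone n unit below harmonic-CM 0 0 ⟩
      mul n us′ harmonic 0                    ≡⟨ Q-0 (mul n us′ harmonic) ⟨
      Q (mul n us′ harmonic) 0ℚ               ≤⟨ Q-mul-≤ n unit′ ≤-refl (≤-reflexive 0+sum≡) harmonic-CM ⟩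
      Q harmonic (0ℚ + Sum n us′)             ≡⟨ cong (Q harmonic) 0+sum≡ ⟩
      Q harmonic (ℤ.+ 3 / 2)                  ≤⟨ Q-harmonic-3/2 ⟩
      bound                                   ∎
      where
      0+sum≡ : 0ℚ + Sum n us′ ≡ ℤ.+ 3 / 2
      0+sum≡ = trans (+-identityˡ _) sum≡
      unit′ : ∀ i → Unit (us′ i)
      unit′ i = proj₁ (below i) , ≤-trans (proj₂ (below i)) (proj₂ (unit i))

  -- The hypothesis on the total only says that `y` is at least `y′` - ε/2. Replacing `y` by `y′`
  -- costs at most this deficit times the first moment, which is at most 1/2; a larger `y` only
  -- lowers the left side.
  averaged-bound : ∀ n {us y ε} → (∀ i → Unit (us i)) → Unit y → 0ℚ ≤ ε →
                   ℤ.+ 11 / 6 ≤ (y + y) + Sum n us + ε → (y ▷ mul n us harmonic) 0 ≤ bound + ε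
  averaged-bound n {us} {y} {ε} unit unit-y 0≤ε total = cases (≤-total c (ℤ.+ 3 / 2))
    where
    open ≤-Reasoning
    A : ℕ → ℚ
    A = mul n us harmonic
    A-CM : CompletelyMonotone A
    A-CM = mul-CM n unit harmonic-CM
    c y′ : ℚ
    c = Sum n us
    y′ = ℤ.+ 11 / 12 - ½ * c

    change : ∀ p q y z → p - y * q ≡ (p - z * q) + (z - y) * q
    change = solve 4 (λ p q y z → p :- y :* q := (p :- z :* q) :+ (z :- y) :* q) refl

    y′-y≤ : y′ - y ≤ ½ * ε
    y′-y≤ = ≤-by (eq c y ε) (0≤* (from-yes (0ℚ ≤? ½)) (≤⇒0≤- total))
      where
      eq : ∀ c y e → ½ * e ≡ ℤ.+ 11 / 12 - ½ * c - y + ½ * (((y + y) + c + e) - ℤ.+ 11 / 6)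
      eq = solve 3 (λ c y e → con ½ :* e := con (ℤ.+ 11 / 12) :- con ½ :* c :- y
                              :+ con ½ :* (((y :+ y) :+ c :+ e) :- con (ℤ.+ 11 / 6))) refl

    half-half : ½ * ε * ½ ≤ ε
    half-half = ≤-by (solve 1 (λ e → e := con ½ :* e :* con ½ :+ con (ℤ.+ 3 / 4) :* e) refl ε)
      (0≤* (from-yes (0ℚ ≤? ℤ.+ 3 / 4)) 0≤ε)

    error : (y′ - y) * A 1 ≤ ε
    error = begin
      (y′ - y) * A 1     ≤⟨ *-monoʳ-≤-nonNeg (A 1) {{nonNegative (A-CM 0 1)}} y′-y≤ ⟩
      ½ * ε * A 1        ≤⟨ *-monoˡ (0≤* (from-yes (0ℚ ≤? ½)) 0≤ε) (≤-trans (mul-≤ n unit harmonic-CM 1) (≤-reflexive harmonic-1)) ⟩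
      ½ * ε * ½          ≤⟨ half-half ⟩
      ε                  ∎

    cases : c ≤ ℤ.+ 3 / 2 ⊎ ℤ.+ 3 / 2 ≤ c → (y ▷ A) 0 ≤ bound + ε
    cases (inj₁ c≤) = begin
      (y ▷ A) 0                       ≡⟨ change (A 0) (A 1) y y′ ⟩
      (y′ ▷ A) 0 + (y′ - y) * A 1     ≤⟨ +-mono-≤ (balanced-bound n unit c≤) error ⟩
      bound + ε                       ∎
    cases (inj₂ ≤c) = begin
      (y ▷ A) 0                       ≤⟨ ▷-≤ A-CM (proj₁ unit-y) 0 ⟩
      A 0                             ≤⟨ large-sum-bound n unit ≤c ⟩
      bound                           ≤⟨ p≤p+ bound 0≤ε ⟩
      bound + ε                       ∎

-- Averages over random orders as moments

module RandomOrder where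

  open RationalArithmetic
  open Moments
  open import Data.Bool.Base using (Bool; true; false; if_then_else_)
  open import Data.Fin.Permutation using (Permutation′; insert; _⟨$⟩ʳ_)
  open import Data.Fin.Properties using (toℕ≤pred[n])
  open import Data.List.Base using (List; []; _∷_; _++_; map; tabulate; allFin; cartesianProductWith)
  open import Data.Nat.Base using (_<ᵇ_)
  open import Data.Rational.Base
  open import Data.Rational.Properties
  open import Data.Rational.Solver using (module +-*-Solver)
  open +-*-Solver

  sumOver : {A : Set} → List A → (A → ℚ) → ℚ
  sumOver []       f = 0ℚ
  sumOver (a ∷ as) f = f a + sumOver as f

  sumOver-cong : {A : Set} (as : List A) {f g : A → ℚ} → (∀ a → f a ≡ g a) → sumOver as f ≡ sumOver as g
  sumOver-cong []       f≡g = refl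
  sumOver-cong (a ∷ as) f≡g = cong₂ _+_ (f≡g a) (sumOver-cong as f≡g)

  sumOver-+ : {A : Set} (as : List A) (f g : A → ℚ) → sumOver as (λ a → f a + g a) ≡ sumOver as f + sumOver as g
  sumOver-+ []       f g = refl
  sumOver-+ (a ∷ as) f g = trans (cong (f a + g a +_) (sumOver-+ as f g))
    (solve 4 (λ a b c d → a :+ b :+ (c :+ d) := a :+ c :+ (b :+ d)) refl (f a) (g a) (sumOver as f) (sumOver as g))

  sumOver-*ˡ : {A : Set} (as : List A) (c : ℚ) (f : A → ℚ) → sumOver as (λ a → c * f a) ≡ c * sumOver as f
  sumOver-*ˡ []       c f = sym (*-zeroʳ c)
  sumOver-*ˡ (a ∷ as) c f = trans (cong (c * f a +_) (sumOver-*ˡ as c f)) (sym (*-distribˡ-+ c (f a) (sumOver as f)))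

  sumOver-++ : {A : Set} (as bs : List A) (f : A → ℚ) → sumOver (as ++ bs) f ≡ sumOver as f + sumOver bs f
  sumOver-++ []       bs f = sym (+-identityˡ (sumOver bs f))
  sumOver-++ (a ∷ as) bs f = trans (cong (f a +_) (sumOver-++ as bs f)) (sym (+-assoc (f a) (sumOver as f) (sumOver bs f)))

  sumOver-map : {A B : Set} (h : A → B) (as : List A) (f : B → ℚ) → sumOver (map h as) f ≡ sumOver as (λ a → f (h a))
  sumOver-map h []       f = refl
  sumOver-map h (a ∷ as) f = cong (f (h a) +_) (sumOver-map h as f)

  sumOver-tabulate : ∀ {A : Set} n (h : Fin n → A) (f : A → ℚ) → sumOver (tabulate h) f ≡ Sum n (λ i → f (h i))
  sumOver-tabulate zero    h f = refl
  sumOver-tabulate (suc n) h f = cong (f (h zero) +_) (sumOver-tabulate n (λ i → h (suc i)) f)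

  sumOver-cartesianProductWith : {A B C : Set} (h : A → B → C) (as : List A) (bs : List B) (f : C → ℚ) →
    sumOver (cartesianProductWith h as bs) f ≡ sumOver as (λ a → sumOver bs (λ b → f (h a b)))
  sumOver-cartesianProductWith h []       bs f = refl
  sumOver-cartesianProductWith h (a ∷ as) bs f = trans (sumOver-++ (map (h a) bs) _ f)
    (cong₂ _+_ (sumOver-map (h a) bs f) (sumOver-cartesianProductWith h as bs f))

  sumOver-permutations : ∀ n (f : Permutation′ (suc n) → ℚ) →
    sumOver (permutations (suc n)) f ≡ Sum (suc n) (λ j → sumOver (permutations n) (λ ρ → f (insert zero j ρ)))
  sumOver-permutations n f = trans
    (sumOver-cartesianProductWith (insert zero) (allFin (suc n)) (permutations n) f)
    (sumOver-tabulate (suc n) (λ j → j) (λ j → sumOver (permutations n) (λ ρ → f (insert zero j ρ))))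

  Sum-0 : ∀ n → Sum n (λ _ → 0ℚ) ≡ 0ℚ
  Sum-0 zero    = refl
  Sum-0 (suc n) = trans (+-identityˡ _) (Sum-0 n)

  Sum-sumOver : ∀ {A : Set} n (as : List A) (f : Fin n → A → ℚ) →
    Sum n (λ j → sumOver as (f j)) ≡ sumOver as (λ a → Sum n (λ j → f j a))
  Sum-sumOver n []       f = Sum-0 n
  Sum-sumOver n (a ∷ as) f = trans (Sum-+ n (λ j → f j a) (λ j → sumOver as (f j)))
    (cong (Sum n (λ j → f j a) +_) (Sum-sumOver n as f))

  Prod : ∀ n → (Fin n → ℚ) → ℚ
  Prod zero    f = 1ℚ
  Prod (suc n) f = f zero * Prod n (λ i → f (suc i))

  Prod-cong : ∀ n {f g} → (∀ i → f i ≡ g i) → Prod n f ≡ Prod n g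
  Prod-cong zero    f≡g = refl
  Prod-cong (suc n) f≡g = cong₂ _*_ (f≡g zero) (Prod-cong n (λ i → f≡g (suc i)))

  gate : Bool → ℚ → ℚ
  gate true  w = w
  gate false w = 1ℚ

  n<ᵇn : ∀ n → (n <ᵇ n) ≡ false
  n<ᵇn zero    = refl
  n<ᵇn (suc n) = n<ᵇn n

  punchIn-<ᵇ-true : ∀ {n} (j : Fin (suc n)) (r : Fin n) m → (toℕ j <ᵇ m) ≡ true →
                    (toℕ (punchIn j r) <ᵇ m) ≡ (toℕ r <ᵇ ℕ.pred m)
  punchIn-<ᵇ-true zero    r       (suc m)       j<m = refl
  punchIn-<ᵇ-true (suc j) zero    (suc (suc m)) j<m = refl
  punchIn-<ᵇ-true (suc j) (suc r) (suc (suc m)) j<m = punchIn-<ᵇ-true j r (suc m) j<m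

  punchIn-<ᵇ-false : ∀ {n} (j : Fin (suc n)) (r : Fin n) m → (toℕ j <ᵇ m) ≡ false →
                     (toℕ (punchIn j r) <ᵇ m) ≡ (toℕ r <ᵇ m)
  punchIn-<ᵇ-false j       r       zero    j≮m = refl
  punchIn-<ᵇ-false (suc j) zero    (suc m) j≮m = refl
  punchIn-<ᵇ-false (suc j) (suc r) (suc m) j≮m = punchIn-<ᵇ-false j r m j≮m

  punchIn-<ᵇ-punchIn : ∀ {n} (j : Fin (suc n)) (r s : Fin n) →
                       (toℕ (punchIn j r) <ᵇ toℕ (punchIn j s)) ≡ (toℕ r <ᵇ toℕ s)
  punchIn-<ᵇ-punchIn zero    r       s       = refl
  punchIn-<ᵇ-punchIn (suc j) zero    zero    = refl
  punchIn-<ᵇ-punchIn (suc j) zero    (suc s) = refl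
  punchIn-<ᵇ-punchIn (suc j) (suc r) zero    = refl
  punchIn-<ᵇ-punchIn (suc j) (suc r) (suc s) = punchIn-<ᵇ-punchIn j r s

  <ᵇ-punchIn : ∀ {n} (j : Fin (suc n)) (r : Fin n) → (toℕ j <ᵇ toℕ (punchIn j r)) ≡ (toℕ j <ᵇ suc (toℕ r))
  <ᵇ-punchIn zero    r       = refl
  <ᵇ-punchIn (suc j) zero    = refl
  <ᵇ-punchIn (suc j) (suc r) = <ᵇ-punchIn j r

  Sum-const : ∀ n B → Sum n (λ _ → B) ≡ ι n * B
  Sum-const zero    B = trans (sym (*-zeroˡ B)) (cong (_* B) (sym ι-0))
  Sum-const (suc n) B = trans (cong (B +_) (Sum-const n B))
    (trans (solve 2 (λ b n → b :+ n :* b := (con 1ℚ :+ n) :* b) refl B (ι n)) (cong (_* B) (sym (ι-suc n))))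

  Sum-threshold : ∀ n m A B → m ℕ.≤ n →
    Sum n (λ j → if toℕ j <ᵇ m then A else B) ≡ ι m * A + ι (n ℕ.∸ m) * B
  Sum-threshold n       zero    A B m≤n = trans (Sum-const n B)
    (trans (sym (+-identityˡ (ι n * B))) (cong (_+ ι n * B) (trans (sym (*-zeroˡ A)) (cong (_* A) (sym ι-0)))))
  Sum-threshold (suc n) (suc m) A B (ℕ.s≤s m≤n) = trans (cong (A +_) (Sum-threshold n m A B m≤n))
    (trans (solve 4 (λ a m x b → a :+ (m :* a :+ x :* b) := (con 1ℚ :+ m) :* a :+ x :* b) refl A (ι m) (ι (n ℕ.∸ m)) B)
           (cong (λ z → z * A + ι (n ℕ.∸ m) * B) (sym (ι-suc m))))

  before : ∀ {n} → (Fin n → ℚ) → Permutation′ n → ℕ → ℚ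
  before {n} w ρ m = Prod n (λ i → gate (toℕ (ρ ⟨$⟩ʳ i) <ᵇ m) (w i))

  -- For m ≤ n this is m!(n - m)! times the m-th elementary symmetric function of `w`.
  orderSum : ∀ n → (Fin n → ℚ) → ℕ → ℚ
  orderSum n w m = sumOver (permutations n) (λ ρ → before w ρ m)

  -- Split by the position j of the first element. Either it is one of the first m, contributing
  -- `w zero` and leaving m - 1 places to the others, or it is not and leaves all m. Up to
  -- factorials this is the recursion for elementary symmetric functions.
  orderSum-suc : ∀ n (w : Fin (suc n) → ℚ) m → m ℕ.≤ suc n → orderSum (suc n) w m ≡
    ι m * (w zero * orderSum n (λ i → w (suc i)) (ℕ.pred m)) + ι (suc n ℕ.∸ m) * orderSum n (λ i → w (suc i)) m
  orderSum-suc n w m m≤ = begin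
    orderSum (suc n) w m
      ≡⟨ sumOver-permutations n (λ ρ → before w ρ m) ⟩
    Sum (suc n) (λ j → sumOver (permutations n) (λ ρ → before w (insert zero j ρ) m))
      ≡⟨ Sum-cong (suc n) inner ⟩
    Sum (suc n) (λ j → if toℕ j <ᵇ m then X else Y)
      ≡⟨ Sum-threshold (suc n) m X Y m≤ ⟩
    ι m * X + ι (suc n ℕ.∸ m) * Y ∎
    where
    open ≡-Reasoning
    w′ : Fin n → ℚ
    w′ i = w (suc i)
    X Y : ℚ
    X = w zero * orderSum n w′ (ℕ.pred m)
    Y = orderSum n w′ m
    inner : ∀ j → sumOver (permutations n) (λ ρ → before w (insert zero j ρ) m) ≡ (if toℕ j <ᵇ m then X else Y)
    inner j with toℕ j <ᵇ m in j<m
    ... | true  = trans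
      (sumOver-cong (permutations n) (λ ρ → cong (w zero *_)
        (Prod-cong n (λ i → cong (λ b → gate b (w′ i)) (punchIn-<ᵇ-true j (ρ ⟨$⟩ʳ i) m j<m)))))
      (sumOver-*ˡ (permutations n) (w zero) (λ ρ → before w′ ρ (ℕ.pred m)))
    ... | false = sumOver-cong (permutations n) (λ ρ → trans (*-identityˡ _)
        (Prod-cong n (λ i → cong (λ b → gate b (w′ i)) (punchIn-<ᵇ-false j (ρ ⟨$⟩ʳ i) m j<m))))

  -- Summation by parts: after a shift of index in the terms containing `w zero`, the whole
  -- recursion acts on the weight `g` instead of on `orderSum`.
  Sum-orderSum-suc : ∀ n (w : Fin (suc n) → ℚ) (g : ℕ → ℚ) →
    Sum (2 ℕ.+ n) (λ j → g (toℕ j) * orderSum (suc n) w (toℕ j)) ≡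
    Sum (suc n) (λ j → (ι (suc (toℕ j)) * (w zero * g (suc (toℕ j))) + ι (suc n ℕ.∸ toℕ j) * g (toℕ j))
                       * orderSum n (λ i → w (suc i)) (toℕ j))
  Sum-orderSum-suc n w g = begin
    Sum (2 ℕ.+ n) (λ j → g (toℕ j) * orderSum (suc n) w (toℕ j))
      ≡⟨ Sum-cong (2 ℕ.+ n) (λ j → trans (cong (g (toℕ j) *_) (orderSum-suc n w (toℕ j) (toℕ≤pred[n] j)))
           (expand (g (toℕ j)) (ι (toℕ j)) (w zero) (S (ℕ.pred (toℕ j))) (ι (suc n ℕ.∸ toℕ j)) (S (toℕ j)))) ⟩
    Sum (2 ℕ.+ n) (λ j → inside (toℕ j) + outside (toℕ j))
      ≡⟨ Sum-+ (2 ℕ.+ n) (λ j → inside (toℕ j)) (λ j → outside (toℕ j)) ⟩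
    (inside 0 + Sum (suc n) (λ j → inside (suc (toℕ j)))) + Sum (2 ℕ.+ n) (λ j → outside (toℕ j))
      ≡⟨ cong₂ _+_ (trans (cong (_+ Sum (suc n) (λ j → inside (suc (toℕ j)))) inside-0) (+-identityˡ (Sum (suc n) (λ j → inside (suc (toℕ j))))))
           (trans (Sum-last (suc n) outside) (trans (cong (Sum (suc n) (λ j → outside (toℕ j)) +_) outside-last) (+-identityʳ (Sum (suc n) (λ j → outside (toℕ j)))))) ⟩
    Sum (suc n) (λ j → inside (suc (toℕ j))) + Sum (suc n) (λ j → outside (toℕ j))
      ≡⟨ Sum-+ (suc n) (λ j → inside (suc (toℕ j))) (λ j → outside (toℕ j)) ⟨
    Sum (suc n) (λ j → inside (suc (toℕ j)) + outside (toℕ j))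
      ≡⟨ Sum-cong (suc n) (λ j → sym (*-distribʳ-+ (S (toℕ j)) (ι (suc (toℕ j)) * (w zero * g (suc (toℕ j)))) (ι (suc n ℕ.∸ toℕ j) * g (toℕ j)))) ⟩
    Sum (suc n) (λ j → (ι (suc (toℕ j)) * (w zero * g (suc (toℕ j))) + ι (suc n ℕ.∸ toℕ j) * g (toℕ j)) * S (toℕ j)) ∎
    where
    open ≡-Reasoning
    S inside outside : ℕ → ℚ
    S = orderSum n (λ i → w (suc i))
    inside j = ι j * (w zero * g j) * S (ℕ.pred j)
    outside j = ι (suc n ℕ.∸ j) * g j * S j
    expand : ∀ g k w p l q → g * (k * (w * p) + l * q) ≡ k * (w * g) * p + l * g * q
    expand = solve 6 (λ g k w p l q → g :* (k :* (w :* p) :+ l :* q) := k :* (w :* g) :* p :+ l :* g :* q) refl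
    vanish : ∀ {z} p q → z ≡ 0ℚ → z * p * q ≡ 0ℚ
    vanish p q refl = trans (cong (_* q) (*-zeroˡ p)) (*-zeroˡ q)
    -- `ℕ.pred 0` is 0 and `S (suc n)` is beyond the meaningful range, but both boundary terms carry
    -- the coefficient 0.
    inside-0 : inside 0 ≡ 0ℚ
    inside-0 = vanish (w zero * g 0) (S 0) ι-0
    outside-last : outside (suc n) ≡ 0ℚ
    outside-last = vanish (g (suc n)) (S (suc n)) (trans (cong ι (ℕ.n∸n≡0 (suc n))) ι-0)

  -- (j+1)⋯(j+a), which divided by (n+a+1)! is ∫₀¹ tʲ⁺ᵃ(1 − t)ⁿ⁻ʲ dt / (j!(n−j)!).
  rising : ℕ → ℕ → ℚ
  rising zero    j = 1ℚ
  rising (suc a) j = rising a j * ι (suc (j ℕ.+ a))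

  rising-suc : ∀ a j → ι (suc j) * rising a (suc j) ≡ rising (suc a) j
  rising-suc zero    j = trans (*-comm (ι (suc j)) 1ℚ) (cong (λ m → 1ℚ * ι (suc m)) (sym (ℕ.+-identityʳ j)))
  rising-suc (suc a) j = trans (sym (*-assoc (ι (suc j)) (rising a (suc j)) (ι (suc (suc j ℕ.+ a)))))
    (cong₂ (λ p m → p * ι (suc m)) (rising-suc a j) (sym (ℕ.+-suc j a)))

  rising-0 : ∀ a → rising a 0 ≡ ι (a !)
  rising-0 zero    = sym ι-1
  rising-0 (suc a) = trans (cong (_* ι (suc a)) (rising-0 a))
    (trans (*-comm (ι (a !)) (ι (suc a))) (sym (ι-* (suc a) (a !))))

  -- On the weights `rising a`, the recursion mirrors tᵃ(1 - tu) = tᵃ - u tᵃ⁺¹. It holds because (n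
  -- + 1 - j) + (j + a + 1) = n + a + 2 does not depend on j.
  rising-step : ∀ n u a j → j ℕ.≤ n →
    ι (suc j) * ((1ℚ - u) * rising a (suc j)) + ι (suc n ℕ.∸ j) * rising a j
    ≡ ι (2 ℕ.+ (n ℕ.+ a)) * rising a j + (- u) * rising (suc a) j
  rising-step n u a j j≤n = begin
    ι (suc j) * ((1ℚ - u) * rising a (suc j)) + d * R
      ≡⟨ solve 4 (λ i u r x → i :* ((con 1ℚ :- u) :* r) :+ x := (con 1ℚ :- u) :* (i :* r) :+ x) refl (ι (suc j)) u (rising a (suc j)) (d * R) ⟩
    (1ℚ - u) * (ι (suc j) * rising a (suc j)) + d * R
      ≡⟨ cong (λ z → (1ℚ - u) * z + d * R) (rising-suc a j) ⟩
    (1ℚ - u) * (R * k) + d * R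
      ≡⟨ solve 4 (λ u r k d → (con 1ℚ :- u) :* (r :* k) :+ d :* r := (d :+ k) :* r :+ (:- u) :* (r :* k)) refl u R k d ⟩
    (d + k) * R + (- u) * (R * k)
      ≡⟨ cong (λ z → z * R + (- u) * (R * k)) (trans (sym (ι-+ (suc n ℕ.∸ j) (suc (j ℕ.+ a)))) (cong ι total)) ⟩
    ι (2 ℕ.+ (n ℕ.+ a)) * R + (- u) * (R * k) ∎
    where
    open ≡-Reasoning
    R d k : ℚ
    R = rising a j
    d = ι (suc n ℕ.∸ j)
    k = ι (suc (j ℕ.+ a))
    total : (suc n ℕ.∸ j) ℕ.+ suc (j ℕ.+ a) ≡ 2 ℕ.+ (n ℕ.+ a)
    total = trans (ℕ.+-suc (suc n ℕ.∸ j) (j ℕ.+ a)) (cong suc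
      (trans (sym (ℕ.+-assoc (suc n ℕ.∸ j) j a)) (cong (ℕ._+ a) (ℕ.m∸n+n≡m (ℕ.m≤n⇒m≤1+n j≤n)))))

  -- With w = 1 - u, the product of the factors tw + (1 - t) is the sum over j of eⱼ(w) tʲ(1 -
  -- t)ⁿ⁻ʲ. Integrating against tᵃ gives Beta integrals, and `orderSum` = j!(n - j)! eⱼ(w) turns
  -- them into the weights `rising a j`/(n + a + 1)!. The induction on n needs all `a`, as each
  -- factor also involves the next moment.
  moment : ∀ n us a → Sum (suc n) (λ j → rising a (toℕ j) * orderSum n (λ i → 1ℚ - us i) (toℕ j))
                      ≡ ι ((suc (n ℕ.+ a)) !) * mul n us harmonic a

  -- Besides giving the step of `moment`, this is the form in which the sum for the second terminal
  -- arises, where the first terminal's factor appears in the weights.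
  moment-step : ∀ n us u a →
    Sum (suc n) (λ j → (ι (suc (toℕ j)) * ((1ℚ - u) * rising a (suc (toℕ j))) + ι (suc n ℕ.∸ toℕ j) * rising a (toℕ j))
                       * orderSum n (λ i → 1ℚ - us i) (toℕ j))
    ≡ ι ((2 ℕ.+ (n ℕ.+ a)) !) * (u ▷ mul n us harmonic) a
  moment-step n us u a = begin
    Sum (suc n) (λ j → (ι (suc (toℕ j)) * ((1ℚ - u) * rising a (suc (toℕ j))) + ι (suc n ℕ.∸ toℕ j) * rising a (toℕ j)) * S (toℕ j))
      ≡⟨ Sum-cong (suc n) (λ j → trans (cong (_* S (toℕ j)) (rising-step n u a (toℕ j) (toℕ≤pred[n] j)))
           (distrib N (rising a (toℕ j)) (- u) (rising (suc a) (toℕ j)) (S (toℕ j)))) ⟩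
    Sum (suc n) (λ j → N * (rising a (toℕ j) * S (toℕ j)) + (- u) * (rising (suc a) (toℕ j) * S (toℕ j)))
      ≡⟨ Sum-+ (suc n) (λ j → N * (rising a (toℕ j) * S (toℕ j))) (λ j → (- u) * (rising (suc a) (toℕ j) * S (toℕ j))) ⟩
    Sum (suc n) (λ j → N * (rising a (toℕ j) * S (toℕ j))) + Sum (suc n) (λ j → (- u) * (rising (suc a) (toℕ j) * S (toℕ j)))
      ≡⟨ cong₂ _+_ (Sum-*ˡ (suc n) N (λ j → rising a (toℕ j) * S (toℕ j))) (Sum-*ˡ (suc n) (- u) (λ j → rising (suc a) (toℕ j) * S (toℕ j))) ⟩
    N * Sum (suc n) (λ j → rising a (toℕ j) * S (toℕ j)) + (- u) * Sum (suc n) (λ j → rising (suc a) (toℕ j) * S (toℕ j))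
      ≡⟨ cong₂ (λ p q → N * p + (- u) * q) (moment n us a) (trans (moment n us (suc a)) (cong (λ m → ι ((suc m) !) * M (suc a)) (ℕ.+-suc n a))) ⟩
    N * (f * M a) + (- u) * (ι ((2 ℕ.+ (n ℕ.+ a)) !) * M (suc a))
      ≡⟨ cong (λ z → N * (f * M a) + (- u) * (z * M (suc a))) N! ⟩
    N * (f * M a) + (- u) * (N * f * M (suc a))
      ≡⟨ solve 5 (λ N f p u q → N :* (f :* p) :+ (:- u) :* (N :* f :* q) := N :* f :* (p :- u :* q)) refl N f (M a) u (M (suc a)) ⟩
    N * f * (u ▷ M) a
      ≡⟨ cong (_* (u ▷ M) a) N! ⟨
    ι ((2 ℕ.+ (n ℕ.+ a)) !) * (u ▷ M) a ∎
    where
    open ≡-Reasoning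
    S M : ℕ → ℚ
    S = orderSum n (λ i → 1ℚ - us i)
    M = mul n us harmonic
    N f : ℚ
    N = ι (2 ℕ.+ (n ℕ.+ a))
    f = ι ((suc (n ℕ.+ a)) !)
    N! : ι ((2 ℕ.+ (n ℕ.+ a)) !) ≡ N * f
    N! = ι-* (2 ℕ.+ (n ℕ.+ a)) ((suc (n ℕ.+ a)) !)
    distrib : ∀ n r u s x → (n * r + u * s) * x ≡ n * (r * x) + u * (s * x)
    distrib = solve 5 (λ n r u s x → (n :* r :+ u :* s) :* x := n :* (r :* x) :+ u :* (s :* x)) refl

  moment zero    us a = begin
    rising a 0 * (1ℚ + 0ℚ) + 0ℚ            ≡⟨ solve 1 (λ r → r :* (con 1ℚ :+ con 0ℚ) :+ con 0ℚ := r) refl (rising a 0) ⟩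
    rising a 0                             ≡⟨ rising-0 a ⟩
    ι (a !)                                ≡⟨ *-identityʳ (ι (a !)) ⟨
    ι (a !) * 1ℚ                           ≡⟨ cong (ι (a !) *_) (ι*harmonic a) ⟨
    ι (a !) * (ι (suc a) * harmonic a)     ≡⟨ solve 3 (λ f s h → f :* (s :* h) := s :* f :* h) refl (ι (a !)) (ι (suc a)) (harmonic a) ⟩
    ι (suc a) * ι (a !) * harmonic a       ≡⟨ cong (_* harmonic a) (ι-* (suc a) (a !)) ⟨
    ι ((suc a) !) * harmonic a             ∎
    where open ≡-Reasoning
  moment (suc n) us a = trans (Sum-orderSum-suc n (λ i → 1ℚ - us i) (rising a)) (moment-step n (λ i → us (suc i)) (us zero) a)

  before-first : ∀ {n} (w : Fin (suc n) → ℚ) j (ρ : Permutation′ n) →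
                 before w (insert zero j ρ) (toℕ j) ≡ before (λ i → w (suc i)) ρ (toℕ j)
  before-first {n} w j ρ = trans (cong₂ _*_ (cong (λ b → gate b (w zero)) (n<ᵇn (toℕ j)))
      (Prod-cong n (λ i → cong (λ b → gate b (w (suc i))) (punchIn-<ᵇ-false j (ρ ⟨$⟩ʳ i) (toℕ j) (n<ᵇn (toℕ j))))))
    (*-identityˡ _)

  captureSum : ∀ {n} → (Fin n → ℚ) → Fin n → ℚ
  captureSum {n} w t = sumOver (permutations n) (λ σ → before w σ (toℕ (σ ⟨$⟩ʳ t)))

  captureSum-first : ∀ n (us : Fin (suc n) → ℚ) →
    captureSum {suc n} (λ i → 1ℚ - us i) zero ≡ ι ((suc n) !) * mul n (λ i → us (suc i)) harmonic 0
  captureSum-first n us = begin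
    captureSum w zero
      ≡⟨ sumOver-permutations n (λ σ → before w σ (toℕ (σ ⟨$⟩ʳ zero))) ⟩
    Sum (suc n) (λ j → sumOver (permutations n) (λ ρ → before w (insert zero j ρ) (toℕ j)))
      ≡⟨ Sum-cong (suc n) (λ j → trans (sumOver-cong (permutations n) (before-first w j)) (sym (*-identityˡ _))) ⟩
    Sum (suc n) (λ j → rising 0 (toℕ j) * orderSum n (λ i → w (suc i)) (toℕ j))
      ≡⟨ moment n (λ i → us (suc i)) 0 ⟩
    ι ((suc (n ℕ.+ 0)) !) * M
      ≡⟨ cong (λ m → ι ((suc m) !) * M) (ℕ.+-identityʳ n) ⟩
    ι ((suc n) !) * M ∎
    where
    open ≡-Reasoning
    w : Fin (suc n) → ℚ
    w i = 1ℚ - us i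
    M : ℚ
    M = mul n (λ i → us (suc i)) harmonic 0

  -- `insert zero j ρ` puts the first terminal at place j, ahead of the second exactly when j is at
  -- most the second one's rank in ρ. Summing over j first gives a weight depending only on this
  -- rank; what remains is the situation of `captureSum-first` with weights.
  captureSum-second : ∀ n (us : Fin (2 ℕ.+ n) → ℚ) →
    captureSum {2 ℕ.+ n} (λ i → 1ℚ - us i) (suc zero) ≡
    ι ((2 ℕ.+ n) !) * (us zero ▷ mul n (λ i → us (suc (suc i))) harmonic) 0
  captureSum-second n us = begin
    captureSum w (suc zero)
      ≡⟨ sumOver-permutations (suc n) (λ σ → before w σ (toℕ (σ ⟨$⟩ʳ suc zero))) ⟩
    Sum (2 ℕ.+ n) (λ j → sumOver (permutations (suc n)) (λ ρ → before w (insert zero j ρ) (toℕ (punchIn j (ρ ⟨$⟩ʳ zero)))))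
      ≡⟨ Sum-cong (2 ℕ.+ n) (λ j → sumOver-cong (permutations (suc n)) (λ ρ → split j ρ)) ⟩
    Sum (2 ℕ.+ n) (λ j → sumOver (permutations (suc n)) (λ ρ → if toℕ j <ᵇ suc (rank ρ) then w zero * P ρ else P ρ))
      ≡⟨ Sum-sumOver (2 ℕ.+ n) (permutations (suc n)) (λ j ρ → if toℕ j <ᵇ suc (rank ρ) then w zero * P ρ else P ρ) ⟩
    sumOver (permutations (suc n)) (λ ρ → Sum (2 ℕ.+ n) (λ j → if toℕ j <ᵇ suc (rank ρ) then w zero * P ρ else P ρ))
      ≡⟨ sumOver-cong (permutations (suc n)) (λ ρ → trans
           (Sum-threshold (2 ℕ.+ n) (suc (rank ρ)) (w zero * P ρ) (P ρ) (ℕ.s≤s (ℕ.m≤n⇒m≤1+n (toℕ≤pred[n] (ρ ⟨$⟩ʳ zero)))))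
           (collect (ι (suc (rank ρ))) (w zero) (P ρ) (ι (suc n ℕ.∸ rank ρ)))) ⟩
    sumOver (permutations (suc n)) (λ ρ → coeff (rank ρ) * P ρ)
      ≡⟨ sumOver-permutations n (λ ρ → coeff (rank ρ) * P ρ) ⟩
    Sum (suc n) (λ j → sumOver (permutations n) (λ ρ → coeff (toℕ j) * before w′ (insert zero j ρ) (toℕ j)))
      ≡⟨ Sum-cong (suc n) (λ j → trans
           (sumOver-cong (permutations n) (λ ρ → cong (coeff (toℕ j) *_) (before-first w′ j ρ)))
           (sumOver-*ˡ (permutations n) (coeff (toℕ j)) (λ ρ → before (λ i → w′ (suc i)) ρ (toℕ j)))) ⟩
    Sum (suc n) (λ j → coeff (toℕ j) * orderSum n (λ i → w′ (suc i)) (toℕ j))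
      ≡⟨ moment-step n (λ i → us (suc (suc i))) (us zero) 0 ⟩
    ι ((2 ℕ.+ (n ℕ.+ 0)) !) * M
      ≡⟨ cong (λ m → ι ((2 ℕ.+ m) !) * M) (ℕ.+-identityʳ n) ⟩
    ι ((2 ℕ.+ n) !) * M ∎
    where
    open ≡-Reasoning
    w : Fin (2 ℕ.+ n) → ℚ
    w i = 1ℚ - us i
    w′ : Fin (suc n) → ℚ
    w′ i = w (suc i)
    M : ℚ
    M = (us zero ▷ mul n (λ i → us (suc (suc i))) harmonic) 0
    rank : Permutation′ (suc n) → ℕ
    rank ρ = toℕ (ρ ⟨$⟩ʳ zero)
    P : Permutation′ (suc n) → ℚ
    P ρ = before w′ ρ (rank ρ)
    coeff : ℕ → ℚ
    -- The factors `1ℚ` are the values of `rising 0`, so that these are literally the weights of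
    -- `moment-step` at exponent 0.
    coeff j = ι (suc j) * (w zero * 1ℚ) + ι (suc n ℕ.∸ j) * 1ℚ
    collect : ∀ k w p l → k * (w * p) + l * p ≡ (k * (w * 1ℚ) + l * 1ℚ) * p
    collect = solve 4 (λ k w p l → k :* (w :* p) :+ l :* p := (k :* (w :* con 1ℚ) :+ l :* con 1ℚ) :* p) refl
    gate-* : ∀ b w p → gate b w * p ≡ (if b then w * p else p)
    gate-* true  w p = refl
    gate-* false w p = *-identityˡ p
    split : ∀ j ρ → before w (insert zero j ρ) (toℕ (punchIn j (ρ ⟨$⟩ʳ zero))) ≡
                    (if toℕ j <ᵇ suc (rank ρ) then w zero * P ρ else P ρ)
    split j ρ = trans
      (cong₂ _*_ (cong (λ b → gate b (w zero)) (<ᵇ-punchIn j (ρ ⟨$⟩ʳ zero)))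
        (Prod-cong (suc n) (λ i → cong (λ b → gate b (w′ i)) (punchIn-<ᵇ-punchIn j (ρ ⟨$⟩ʳ i) (ρ ⟨$⟩ʳ zero)))))
      (gate-* (toℕ j <ᵇ suc (rank ρ)) (w zero) (P ρ))

-- Stability of the density under small changes of the factors

module Perturbation where

  open RationalArithmetic
  open Moments
  open RandomOrder
  open import Data.Bool.Base using (Bool; true; false)
  open import Data.Fin.Permutation using (Permutation′; _⟨$⟩ʳ_)
  open import Data.List.Base using (List; []; _∷_; length)
  import Data.Integer.Base as ℤ
  open import Data.Rational.Base
  open import Data.Rational.Properties
  open import Data.Rational.Solver using (module +-*-Solver)
  open +-*-Solver

  -- This is 2ⁿ - 1. A crude constant suffices, because δ is chosen after n.
  lipschitz : ℕ → ℚ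
  lipschitz zero    = 0ℚ
  lipschitz (suc n) = lipschitz n + lipschitz n + 1ℚ

  0≤lipschitz : ∀ n → 0ℚ ≤ lipschitz n
  0≤lipschitz zero    = ≤-refl
  0≤lipschitz (suc n) = 0≤+ (0≤+ (0≤lipschitz n) (0≤lipschitz n)) (from-yes (0ℚ ≤? 1ℚ))

  Unit-* : ∀ {p q} → Unit p → Unit q → Unit (p * q)
  Unit-* {p} {q} (0≤p , p≤1) (0≤q , q≤1) = 0≤* 0≤p 0≤q
    , ≤-trans (*-monoˡ 0≤p q≤1) (≤-trans (≤-reflexive (*-identityʳ p)) p≤1)

  Unit-Prod : ∀ n {g} → (∀ i → Unit (g i)) → Unit (Prod n g)
  Unit-Prod zero    unit = from-yes (0ℚ ≤? 1ℚ) , ≤-refl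
  Unit-Prod (suc n) unit = Unit-* (unit zero) (Unit-Prod n (λ i → unit (suc i)))

  module _ {δ : ℚ} (0≤δ : 0ℚ ≤ δ) (δ≤1 : δ ≤ 1ℚ) where

    -- The asymmetry is deliberate: a rational approximation of a coordinate can be slightly
    -- negative, so the factors `f` may exceed 1, while the clamped factors `g` stay in [0,1].
    Prod-perturb : ∀ n {f g} → (∀ i → 0ℚ ≤ f i) → (∀ i → Unit (g i)) → (∀ i → f i ≤ g i + δ) →
                   Prod n f ≤ Prod n g + lipschitz n * δ
    Prod-perturb zero    0≤f unit f≤g = ≤-reflexive
      (solve 1 (λ d → con 1ℚ := con 1ℚ :+ con 0ℚ :* d) refl δ)
    Prod-perturb (suc n) {f} {g} 0≤f unit f≤g = begin
      f zero * Pf                       ≤⟨ *-monoˡ (0≤f zero) (Prod-perturb n (λ i → 0≤f (suc i)) (λ i → unit (suc i)) (λ i → f≤g (suc i))) ⟩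
      f zero * (Pg + L * δ)             ≤⟨ *-monoʳ-≤-nonNeg (Pg + L * δ) {{nonNegative (0≤+ (proj₁ unit-Pg) (0≤* 0≤L 0≤δ))}} (f≤g zero) ⟩
      (g zero + δ) * (Pg + L * δ)       ≤⟨ ≤-by (eq (g zero) Pg L δ)
                                            (0≤+ (0≤+ (0≤* (≤⇒0≤- (proj₂ (unit zero))) (0≤* 0≤L 0≤δ))
                                                      (0≤* (≤⇒0≤- (proj₂ unit-Pg)) 0≤δ))
                                                 (0≤* (≤⇒0≤- δ≤1) (0≤* 0≤L 0≤δ))) ⟩
      g zero * Pg + (L + L + 1ℚ) * δ    ∎
      where
      open ≤-Reasoning
      Pf Pg L : ℚ
      Pf = Prod n (λ i → f (suc i))
      Pg = Prod n (λ i → g (suc i))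
      L = lipschitz n
      0≤L : 0ℚ ≤ L
      0≤L = 0≤lipschitz n
      unit-Pg : Unit Pg
      unit-Pg = Unit-Prod n (λ i → unit (suc i))
      eq : ∀ g p l d → g * p + (l + l + 1ℚ) * d ≡
           (g + d) * (p + l * d) + ((1ℚ - g) * (l * d) + (1ℚ - p) * d + (1ℚ - d) * (l * d))
      eq = solve 4 (λ g p l d → g :* p :+ (l :+ l :+ con 1ℚ) :* d :=
           (g :+ d) :* (p :+ l :* d) :+ ((con 1ℚ :- g) :* (l :* d) :+ (con 1ℚ :- p) :* d :+ (con 1ℚ :- d) :* (l :* d))) refl

    before-perturb : ∀ {n} {w v : Fin n → ℚ} → (∀ i → 0ℚ ≤ w i) → (∀ i → Unit (v i)) → (∀ i → w i ≤ v i + δ) →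
                     ∀ σ m → before w σ m ≤ before v σ m + lipschitz n * δ
    before-perturb {n} {w} {v} 0≤w unit w≤v σ m = Prod-perturb n
      (λ i → 0≤gate (toℕ (σ ⟨$⟩ʳ i) ℕ.<ᵇ m) (0≤w i))
      (λ i → Unit-gate (toℕ (σ ⟨$⟩ʳ i) ℕ.<ᵇ m) (unit i))
      (λ i → gate-≤ (toℕ (σ ⟨$⟩ʳ i) ℕ.<ᵇ m) (w≤v i))
      where
      0≤gate : ∀ b {p} → 0ℚ ≤ p → 0ℚ ≤ gate b p
      0≤gate true  0≤p = 0≤p
      0≤gate false 0≤p = from-yes (0ℚ ≤? 1ℚ)
      Unit-gate : ∀ b {p} → Unit p → Unit (gate b p)
      Unit-gate true  unit = unit
      Unit-gate false unit = from-yes (0ℚ ≤? 1ℚ) , ≤-refl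
      gate-≤ : ∀ b {p q} → p ≤ q + δ → gate b p ≤ gate b q + δ
      gate-≤ true  p≤q+δ = p≤q+δ
      gate-≤ false p≤q+δ = p≤p+ 1ℚ 0≤δ

  sumOver-mono-+ : {A : Set} (as : List A) {f g : A → ℚ} {c : ℚ} → (∀ a → f a ≤ g a + c) →
                   sumOver as f ≤ sumOver as g + ι (length as) * c
  sumOver-mono-+ []       {f} {g} {c} f≤g = ≤-reflexive (sym (trans (cong (λ z → 0ℚ + z * c) ι-0) (trans (+-identityˡ (0ℚ * c)) (*-zeroˡ c))))
  sumOver-mono-+ (a ∷ as) {f} {g} {c} f≤g = ≤-trans (+-mono-≤ (f≤g a) (sumOver-mono-+ as f≤g))
    (≤-reflexive (trans (eq (g a) (sumOver as g) (ι (length as)) c)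
                        (cong (λ z → g a + sumOver as g + z * c) (sym (ι-suc (length as))))))
    where
    eq : ∀ g s l c → (g + c) + (s + l * c) ≡ g + s + (1ℚ + l) * c
    eq = solve 4 (λ g s l c → (g :+ c) :+ (s :+ l :* c) := g :+ s :+ (con 1ℚ :+ l) :* c) refl

  recip! : ℕ → ℚ
  recip! n = (ℤ.+ 1 / (n !)) {{n ℕ.!≢0}}

  0≤recip! : ∀ n → 0ℚ ≤ recip! n
  0≤recip! n = nonNegative⁻¹ (recip! n) {{normalize-nonNeg 1 (n !) {{n ℕ.!≢0}}}}

  recip!*! : ∀ n → recip! n * ι (n !) ≡ 1ℚ
  recip!*! n = recip-ι (n !) {{n ℕ.!≢0}}

  rationalDensity : ∀ {n} → ℚ → ℚ → (Fin (2 ℕ.+ n) → ℚ) → ℚ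
  rationalDensity {n} f₁ f₂ w = recip! (2 ℕ.+ n) * sumOver (permutations (2 ℕ.+ n))
    (λ σ → f₁ * before w σ (toℕ (σ ⟨$⟩ʳ zero)) + f₂ * before w σ (toℕ (σ ⟨$⟩ʳ suc zero)))

  rationalDensity-moments : ∀ n f₁ f₂ (us : Fin (2 ℕ.+ n) → ℚ) →
    let A = mul n (λ i → us (suc (suc i))) harmonic in
    rationalDensity f₁ f₂ (λ i → 1ℚ - us i) ≡ f₁ * (us (suc zero) ▷ A) 0 + f₂ * (us zero ▷ A) 0
  rationalDensity-moments n f₁ f₂ us = begin
    r * sumOver (permutations k) (λ σ → f₁ * B₁ σ + f₂ * B₂ σ)
      ≡⟨ cong (r *_) (trans (sumOver-+ (permutations k) (λ σ → f₁ * B₁ σ) (λ σ → f₂ * B₂ σ))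
           (cong₂ _+_ (sumOver-*ˡ (permutations k) f₁ B₁) (sumOver-*ˡ (permutations k) f₂ B₂))) ⟩
    r * (f₁ * captureSum w zero + f₂ * captureSum w (suc zero))
      ≡⟨ cong₂ (λ p q → r * (f₁ * p + f₂ * q)) (captureSum-first (suc n) us) (captureSum-second n us) ⟩
    r * (f₁ * (ι (k !) * M₁) + f₂ * (ι (k !) * M₂))
      ≡⟨ collect r (ι (k !)) f₁ f₂ M₁ M₂ ⟩
    (r * ι (k !)) * (f₁ * M₁ + f₂ * M₂)
      ≡⟨ trans (cong (_* (f₁ * M₁ + f₂ * M₂)) (recip!*! k)) (*-identityˡ (f₁ * M₁ + f₂ * M₂)) ⟩
    f₁ * M₁ + f₂ * M₂ ∎
    where
    open ≡-Reasoning
    k : ℕ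
    k = 2 ℕ.+ n
    r M₁ M₂ : ℚ
    r = recip! k
    M₁ = (us (suc zero) ▷ mul n (λ i → us (suc (suc i))) harmonic) 0
    M₂ = (us zero ▷ mul n (λ i → us (suc (suc i))) harmonic) 0
    w : Fin k → ℚ
    w i = 1ℚ - us i
    B₁ B₂ : Permutation′ k → ℚ
    B₁ σ = before w σ (toℕ (σ ⟨$⟩ʳ zero))
    B₂ σ = before w σ (toℕ (σ ⟨$⟩ʳ suc zero))
    collect : ∀ r k f g m n → r * (f * (k * m) + g * (k * n)) ≡ (r * k) * (f * m + g * n)
    collect = solve 6 (λ r k f g m n → r :* (f :* (k :* m) :+ g :* (k :* n)) := (r :* k) :* (f :* m :+ g :* n)) refl

  rationalDensity-perturb : ∀ n {f₁ f₂ δ} {w v : Fin (2 ℕ.+ n) → ℚ} → 0ℚ ≤ f₁ → 0ℚ ≤ f₂ → 0ℚ ≤ δ → δ ≤ 1ℚ →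
    (∀ i → 0ℚ ≤ w i) → (∀ i → Unit (v i)) → (∀ i → w i ≤ v i + δ) →
    rationalDensity f₁ f₂ w ≤ rationalDensity f₁ f₂ v + (f₁ + f₂) * (lipschitz (2 ℕ.+ n) * δ)
  rationalDensity-perturb n {f₁} {f₂} {δ} {w} {v} 0≤f₁ 0≤f₂ 0≤δ δ≤1 0≤w unit w≤v = begin
    r * sumOver ps (term w)                          ≤⟨ *-monoˡ (0≤recip! k) (sumOver-mono-+ ps pointwise) ⟩
    r * (sumOver ps (term v) + ι (length ps) * e)    ≡⟨ cong (λ m → r * (sumOver ps (term v) + ι m * e)) (length-permutations k) ⟩
    r * (sumOver ps (term v) + ι (k !) * e)          ≡⟨ eq₁ r (sumOver ps (term v)) (ι (k !)) e ⟩
    r * sumOver ps (term v) + (r * ι (k !)) * e      ≡⟨ cong (λ z → r * sumOver ps (term v) + z * e) (recip!*! k) ⟩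
    r * sumOver ps (term v) + 1ℚ * e                 ≡⟨ cong (r * sumOver ps (term v) +_) (*-identityˡ e) ⟩
    r * sumOver ps (term v) + e                      ∎
    where
    open ≤-Reasoning
    k : ℕ
    k = 2 ℕ.+ n
    ps : List (Permutation′ k)
    ps = permutations k
    r e : ℚ
    r = recip! k
    e = (f₁ + f₂) * (lipschitz k * δ)
    term : (Fin k → ℚ) → Permutation′ k → ℚ
    term w σ = f₁ * before w σ (toℕ (σ ⟨$⟩ʳ zero)) + f₂ * before w σ (toℕ (σ ⟨$⟩ʳ suc zero))
    eq₁ : ∀ r s k e → r * (s + k * e) ≡ r * s + (r * k) * e
    eq₁ = solve 4 (λ r s k e → r :* (s :+ k :* e) := r :* s :+ (r :* k) :* e) refl
    eq₂ : ∀ f g p q e → f * (p + e) + g * (q + e) ≡ f * p + g * q + (f + g) * e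
    eq₂ = solve 5 (λ f g p q e → f :* (p :+ e) :+ g :* (q :+ e) := f :* p :+ g :* q :+ (f :+ g) :* e) refl
    pointwise : ∀ σ → term w σ ≤ term v σ + e
    pointwise σ = ≤-trans
      (+-mono-≤ (*-monoˡ 0≤f₁ (before-perturb 0≤δ δ≤1 0≤w unit w≤v σ (toℕ (σ ⟨$⟩ʳ zero))))
                (*-monoˡ 0≤f₂ (before-perturb 0≤δ δ≤1 0≤w unit w≤v σ (toℕ (σ ⟨$⟩ʳ suc zero)))))
      (≤-reflexive (eq₂ f₁ f₂ (before v σ (toℕ (σ ⟨$⟩ʳ zero))) (before v σ (toℕ (σ ⟨$⟩ʳ suc zero))) (lipschitz k * δ)))

-- From rational approximations to points of the real simplex

module Approximation where

  open RationalArithmetic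
  open Moments
  open RandomOrder
  open Perturbation
  open import Data.Bool.Base using (Bool; true; false)
  open import Data.Fin.Permutation using (_⟨$⟩ʳ_)
  open import Data.Fin.Properties using (any?; _<?_)
  open import Data.List.Base using (List; []; _∷_; map; filter; tabulate; allFin)
  import Data.Integer.Base as ℤ
  open import Data.Rational.Base
  open import Data.Rational.Properties hiding (_<?_)
  open import Data.Rational.Solver using (module +-*-Solver)
  open import Relation.Nullary using (¬_)
  open import Relation.Unary using (Pred; Decidable)
  open import Level using (0ℓ)
  open +-*-Solver

  clamp : ℚ → ℚ
  clamp z = (z ⊓ 1ℚ) ⊔ 0ℚ

  Unit-clamp : ∀ z → Unit (clamp z)
  Unit-clamp z = p≤q⊔p (z ⊓ 1ℚ) 0ℚ , ⊔-lub (p⊓q≤q z 1ℚ) (from-yes (0ℚ ≤? 1ℚ))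

  Unit-1- : ∀ {u} → Unit u → Unit (1ℚ - u)
  Unit-1- {u} (0≤u , u≤1) = ≤⇒0≤- u≤1 , ≤-by (solve 1 (λ u → con 1ℚ := (con 1ℚ :- u) :+ u) refl u) 0≤u

  ⊓-+-glb : ∀ {p δ} z → p ≤ 1ℚ + δ → p ≤ z + δ → p ≤ (z ⊓ 1ℚ) + δ
  ⊓-+-glb {p} {δ} z p≤1+δ p≤z+δ with ≤-total z 1ℚ
  ... | inj₁ z≤1 = subst (λ q → p ≤ q + δ) (sym (p≤q⇒p⊓q≡p z≤1)) p≤z+δ
  ... | inj₂ 1≤z = subst (λ q → p ≤ q + δ) (sym (p≥q⇒p⊓q≡q 1≤z)) p≤1+δ

  ≤-clamp : ∀ {p δ} z → p ≤ 1ℚ + δ → p ≤ z + δ → p ≤ clamp z + δ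
  ≤-clamp {p} {δ} z p≤1+δ p≤z+δ = ≤-trans (⊓-+-glb z p≤1+δ p≤z+δ) (+-monoˡ-≤ δ (p≤p⊔q (z ⊓ 1ℚ) 0ℚ))

  ≤1⇒≤clamp : ∀ {z} → z ≤ 1ℚ → z ≤ clamp z
  ≤1⇒≤clamp {z} z≤1 = ≤-trans (⊓-glb ≤-refl z≤1) (p≤p⊔q (z ⊓ 1ℚ) 0ℚ)

  clamp-≥1 : ∀ {z} → 1ℚ ≤ z → clamp z ≡ 1ℚ
  clamp-≥1 1≤z = cong (_⊔ 0ℚ) (p≥q⇒p⊓q≡q 1≤z)

  1-⊓-≤-1-clamp : ∀ {z δ} → 0ℚ ≤ δ → 0ℚ ≤ z + δ → 1ℚ - (z ⊓ 1ℚ) ≤ (1ℚ - clamp z) + δ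
  1-⊓-≤-1-clamp {z} {δ} 0≤δ 0≤z+δ = ≤-by (eq (clamp z) (z ⊓ 1ℚ) δ) (≤⇒0≤- clamp≤)
    where
    clamp≤ : clamp z ≤ (z ⊓ 1ℚ) + δ
    clamp≤ = ⊔-lub (p≤p+ (z ⊓ 1ℚ) 0≤δ) (⊓-+-glb z (≤-trans 0≤δ (≤-by (+-comm 1ℚ δ) (from-yes (0ℚ ≤? 1ℚ)))) 0≤z+δ)
    eq : ∀ c m d → (1ℚ - c) + d ≡ (1ℚ - m) + ((m + d) - c)
    eq = solve 3 (λ c m d → (con 1ℚ :- c) :+ d := (con 1ℚ :- m) :+ ((m :+ d) :- c)) refl

  slope : {P : Set} → Dec P → ℚ
  slope (yes _) = ℤ.+ 11 / 6
  slope (no  _) = 0ℚ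

  0≤slope : {P : Set} (d : Dec P) → 0ℚ ≤ slope d
  0≤slope (yes _) = from-yes (0ℚ ≤? ℤ.+ 11 / 6)
  0≤slope (no  _) = ≤-refl

  slope≤2 : {P : Set} (d : Dec P) → slope d ≤ ℤ.+ 2 / 1
  slope≤2 (yes _) = from-yes (ℤ.+ 11 / 6 ≤? ℤ.+ 2 / 1)
  slope≤2 (no  _) = from-yes (0ℚ ≤? ℤ.+ 2 / 1)

  -- What a decision of x ≤ 6/11 still says about a rational approximation of 11/6 x, up to δ.
  Side : {P : Set} → Dec P → ℚ → ℚ → Set
  Side (yes _) δ z = z ≤ 1ℚ + δ
  Side (no  _) δ z = 1ℚ ≤ z + δ

  boundℚ : {P R : Set} → Dec P → Dec R → ℚ
  boundℚ d₁ d₂ = seq (densityBound d₁ d₂) 0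

  tolerance : ℕ → ℚ
  tolerance n = ℤ.+ 4 / 1 * lipschitz (2 ℕ.+ n) + ℤ.+ 11 / 1

  module _ n (z : Fin (2 ℕ.+ n) → ℚ) {δ : ℚ} (0≤δ : 0ℚ ≤ δ) (total : ℤ.+ 11 / 6 ≤ Sum (2 ℕ.+ n) z + δ) where

    private
      us : Fin (2 ℕ.+ n) → ℚ
      us i = clamp (z i)
      rest : Fin n → ℚ
      rest i = us (suc (suc i))
      unit : ∀ i → Unit (us i)
      unit i = Unit-clamp (z i)
      unit-rest : ∀ i → Unit (rest i)
      unit-rest i = unit (suc (suc i))
      A : ℕ → ℚ
      A = mul n rest harmonic
      A-CM : CompletelyMonotone A
      A-CM = mul-CM n unit-rest harmonic-CM
      y : ℚ
      y = ½ * (us zero + us (suc zero))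

    -- Clamping could lose part of the total only at entries above 1. If a terminal after the second
    -- has such an entry, its factor 1 - t alone gives the value 1/2. Otherwise only the first two
    -- entries can lose, by δ each, and the error of the total is the third δ.
    averaged : z zero ≤ 1ℚ + δ → z (suc zero) ≤ 1ℚ + δ → (y ▷ A) 0 ≤ bound + ℤ.+ 3 / 1 * δ
    averaged z₀≤ z₁≤ = cases (any? (λ i → 1ℚ ≤? z (suc (suc i))))
      where
      0≤3δ : 0ℚ ≤ ℤ.+ 3 / 1 * δ
      0≤3δ = 0≤* (from-yes (0ℚ ≤? ℤ.+ 3 / 1)) 0≤δ
      unit-y : Unit y
      unit-y = 0≤* (from-yes (0ℚ ≤? ½)) (0≤+ (proj₁ (unit zero)) (proj₁ (unit (suc zero))))
             , *-monoˡ {½} {us zero + us (suc zero)} {1ℚ + 1ℚ} (from-yes (0ℚ ≤? ½)) (+-mono-≤ (proj₂ (unit zero)) (proj₂ (unit (suc zero))))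
      cases : Dec (Σ[ i ∈ Fin n ] 1ℚ ≤ z (suc (suc i))) → (y ▷ A) 0 ≤ bound + ℤ.+ 3 / 1 * δ
      cases (yes (i , 1≤zᵢ)) = ≤-trans (▷-≤ A-CM (proj₁ unit-y) 0)
        (≤-trans (mul-harmonic-0-≤-½ n unit-rest i (clamp-≥1 1≤zᵢ))
          (≤-trans ½≤bound (p≤p+ bound 0≤3δ)))
      cases (no ¬∃) = averaged-bound n unit-rest unit-y 0≤3δ (≤-trans total sum≤)
        where
        S T : ℚ
        S = Sum n rest
        T = Sum n (λ i → z (suc (suc i)))
        T≤S : T ≤ S
        T≤S = Sum-mono n (λ i → ≤1⇒≤clamp (<⇒≤ (≰⇒> (λ 1≤zᵢ → ¬∃ (i , 1≤zᵢ)))))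
        eq : ∀ u v s d → (u + d) + ((v + d) + s) + d ≡ (½ * (u + v) + ½ * (u + v)) + s + ℤ.+ 3 / 1 * d
        eq = solve 4 (λ u v s d → (u :+ d) :+ ((v :+ d) :+ s) :+ d :=
             (con ½ :* (u :+ v) :+ con ½ :* (u :+ v)) :+ s :+ con (ℤ.+ 3 / 1) :* d) refl
        sum≤ : Sum (2 ℕ.+ n) z + δ ≤ (y + y) + S + ℤ.+ 3 / 1 * δ
        sum≤ = ≤-trans
          (+-monoˡ-≤ δ (+-mono-≤ (≤-clamp (z zero) z₀≤ (p≤p+ (z zero) 0≤δ))
            (+-mono-≤ (≤-clamp (z (suc zero)) z₁≤ (p≤p+ (z (suc zero)) 0≤δ)) T≤S)))
          (≤-reflexive (eq (us zero) (us (suc zero)) S δ))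

    -- All factors but one are dropped, leaving the integral of 1 - tu with `u` nearly 1. The error
    -- 11δ is generous, chosen to equal (11/3)(3δ) from the main case.
    single : ∀ {u} → Unit u → 1ℚ ≤ u + δ → ℤ.+ 11 / 6 * (u ▷ A) 0 ≤ ℤ.+ 11 / 12 + ℤ.+ 11 / 1 * δ
    single {u} unit-u 1≤u+δ = ≤-trans (*-monoˡ (from-yes (0ℚ ≤? ℤ.+ 11 / 6)) (▷-mul-harmonic-≤ n unit-rest unit-u))
      (≤-by (eq u δ) (0≤+ (0≤* (from-yes (0ℚ ≤? ℤ.+ 11 / 12)) (≤⇒0≤- 1≤u+δ)) (0≤* (from-yes (0ℚ ≤? ℤ.+ 121 / 12)) 0≤δ)))
      where
      eq : ∀ u d → ℤ.+ 11 / 12 + ℤ.+ 11 / 1 * d ≡ ℤ.+ 11 / 6 * (1ℚ - u * ½) + (ℤ.+ 11 / 12 * ((u + d) - 1ℚ) + ℤ.+ 121 / 12 * d)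
      eq = solve 2 (λ u d → con (ℤ.+ 11 / 12) :+ con (ℤ.+ 11 / 1) :* d :=
        con (ℤ.+ 11 / 6) :* (con 1ℚ :- u :* con ½) :+ (con (ℤ.+ 11 / 12) :* ((u :+ d) :- con 1ℚ) :+ con (ℤ.+ 121 / 12) :* d)) refl

    moments-bound : {P R : Set} (d₁ : Dec P) (d₂ : Dec R) → Side d₁ δ (z zero) → Side d₂ δ (z (suc zero)) →
      slope d₁ * (us (suc zero) ▷ A) 0 + slope d₂ * (us zero ▷ A) 0 ≤ boundℚ d₁ d₂ + ℤ.+ 11 / 1 * δ
    moments-bound (yes _) (yes _) z₀≤ z₁≤ = begin
      ℤ.+ 11 / 6 * (us (suc zero) ▷ A) 0 + ℤ.+ 11 / 6 * (us zero ▷ A) 0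
        ≡⟨ average (A 0) (A 1) (us zero) (us (suc zero)) ⟩
      ℤ.+ 11 / 3 * (y ▷ A) 0
        ≤⟨ *-monoˡ (from-yes (0ℚ ≤? ℤ.+ 11 / 3)) (averaged z₀≤ z₁≤) ⟩
      ℤ.+ 11 / 3 * (bound + ℤ.+ 3 / 1 * δ)
        ≡⟨ distrib bound δ ⟩
      ℤ.+ 11 / 3 * bound + ℤ.+ 11 / 1 * δ
        ≡⟨ cong (_+ ℤ.+ 11 / 1 * δ) 11/3*bound ⟩
      ℤ.+ 2014096 / 1000000 + ℤ.+ 11 / 1 * δ ∎
      where
      open ≤-Reasoning
      average : ∀ p q u v → ℤ.+ 11 / 6 * (p - v * q) + ℤ.+ 11 / 6 * (p - u * q) ≡ ℤ.+ 11 / 3 * (p - ½ * (u + v) * q)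
      average = solve 4 (λ p q u v → con (ℤ.+ 11 / 6) :* (p :- v :* q) :+ con (ℤ.+ 11 / 6) :* (p :- u :* q) :=
                con (ℤ.+ 11 / 3) :* (p :- con ½ :* (u :+ v) :* q)) refl
      distrib : ∀ b d → ℤ.+ 11 / 3 * (b + ℤ.+ 3 / 1 * d) ≡ ℤ.+ 11 / 3 * b + ℤ.+ 11 / 1 * d
      distrib = solve 2 (λ b d → con (ℤ.+ 11 / 3) :* (b :+ con (ℤ.+ 3 / 1) :* d) := con (ℤ.+ 11 / 3) :* b :+ con (ℤ.+ 11 / 1) :* d) refl
    -- The surviving summand belongs to terminal 1, and its product contains the factor of terminal
    -- 2, whose `u` is nearly 1. The next case is the mirror image.
    moments-bound (yes _) (no _) z₀≤ 1≤z₁ = ≤-trans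
      (≤-reflexive (trans (cong (ℤ.+ 11 / 6 * (us (suc zero) ▷ A) 0 +_) (*-zeroˡ ((us zero ▷ A) 0))) (+-identityʳ (ℤ.+ 11 / 6 * (us (suc zero) ▷ A) 0))))
      (single (unit (suc zero)) (≤-clamp (z (suc zero)) (p≤p+ 1ℚ 0≤δ) 1≤z₁))
    moments-bound (no _) (yes _) 1≤z₀ z₁≤ = ≤-trans
      (≤-reflexive (trans (cong (_+ ℤ.+ 11 / 6 * (us zero ▷ A) 0) (*-zeroˡ ((us (suc zero) ▷ A) 0))) (+-identityˡ (ℤ.+ 11 / 6 * (us zero ▷ A) 0))))
      (single (unit zero) (≤-clamp (z zero) (p≤p+ 1ℚ 0≤δ) 1≤z₀))
    moments-bound (no _) (no _) 1≤z₀ 1≤z₁ = ≤-trans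
      (≤-reflexive (cong₂ _+_ (*-zeroˡ ((us (suc zero) ▷ A) 0)) (*-zeroˡ ((us zero ▷ A) 0))))
      (0≤+ (from-yes (0ℚ ≤? ℤ.+ 11 / 12)) (0≤* (from-yes (0ℚ ≤? ℤ.+ 11 / 1)) 0≤δ))

    rationalDensity-≤ : {P R : Set} (d₁ : Dec P) (d₂ : Dec R) → δ ≤ 1ℚ → (∀ i → 0ℚ ≤ z i + δ) →
      Side d₁ δ (z zero) → Side d₂ δ (z (suc zero)) →
      rationalDensity (slope d₁) (slope d₂) (λ i → 1ℚ - (z i ⊓ 1ℚ)) ≤ boundℚ d₁ d₂ + tolerance n * δ
    rationalDensity-≤ d₁ d₂ δ≤1 0≤z side₁ side₂ = begin
      rationalDensity (slope d₁) (slope d₂) (λ i → 1ℚ - (z i ⊓ 1ℚ))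
        ≤⟨ rationalDensity-perturb n (0≤slope d₁) (0≤slope d₂) 0≤δ δ≤1 (λ i → ≤⇒0≤- (p⊓q≤q (z i) 1ℚ))
             (λ i → Unit-1- (unit i)) (λ i → 1-⊓-≤-1-clamp {z i} 0≤δ (0≤z i)) ⟩
      rationalDensity (slope d₁) (slope d₂) (λ i → 1ℚ - us i) + (slope d₁ + slope d₂) * (L * δ)
        ≡⟨ cong (_+ (slope d₁ + slope d₂) * (L * δ)) (rationalDensity-moments n (slope d₁) (slope d₂) us) ⟩
      slope d₁ * (us (suc zero) ▷ A) 0 + slope d₂ * (us zero ▷ A) 0 + (slope d₁ + slope d₂) * (L * δ)
        ≤⟨ +-mono-≤ (moments-bound d₁ d₂ side₁ side₂)
             (*-monoʳ-≤-nonNeg (L * δ) {{nonNegative (0≤* (0≤lipschitz (2 ℕ.+ n)) 0≤δ)}} (+-mono-≤ (slope≤2 d₁) (slope≤2 d₂))) ⟩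
      boundℚ d₁ d₂ + ℤ.+ 11 / 1 * δ + (ℤ.+ 2 / 1 + ℤ.+ 2 / 1) * (L * δ)
        ≡⟨ collect (boundℚ d₁ d₂) L δ ⟩
      boundℚ d₁ d₂ + tolerance n * δ ∎
      where
      open ≤-Reasoning
      L : ℚ
      L = lipschitz (2 ℕ.+ n)
      collect : ∀ b l d → b + ℤ.+ 11 / 1 * d + (ℤ.+ 2 / 1 + ℤ.+ 2 / 1) * (l * d) ≡ b + (ℤ.+ 4 / 1 * l + ℤ.+ 11 / 1) * d
      collect = solve 3 (λ b l d → b :+ con (ℤ.+ 11 / 1) :* d :+ (con (ℤ.+ 2 / 1) :+ con (ℤ.+ 2 / 1)) :* (l :* d) :=
                b :+ (con (ℤ.+ 4 / 1) :* l :+ con (ℤ.+ 11 / 1)) :* d) refl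

  seq-sumᵣ : ∀ {A : Set} (as : List A) (g : A → ℝ) N → seq (sumᵣ (map g as)) N ≡ sumOver as (λ a → seq (g a) N)
  seq-sumᵣ []       g N = refl
  seq-sumᵣ (a ∷ as) g N = cong (seq (g a) N +_) (seq-sumᵣ as g N)

  seq-productᵣ-filter : ∀ {A : Set} {P : Pred A 0ℓ} (P? : Decidable P) (g : A → ℝ) N n (h : Fin n → A) →
    seq (productᵣ (map g (filter P? (tabulate h)))) N ≡ Prod n (λ i → gate (does (P? (h i))) (seq (g (h i)) N))
  seq-productᵣ-filter P? g N zero    h = refl
  seq-productᵣ-filter P? g N (suc n) h with does (P? (h zero))
  ... | true  = cong (seq (g (h zero)) N *_) (seq-productᵣ-filter P? g N n (λ i → h (suc i)))
  ... | false = trans (seq-productᵣ-filter P? g N n (λ i → h (suc i))) (sym (*-identityˡ _))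

  scaled : ∀ {k} → (Fin k → ℝ) → ℕ → Fin k → ℚ
  scaled x N i = ℤ.+ 11 / 6 * seq (x i) N

  seq-density : ∀ n (x : Fin (2 ℕ.+ n) → ℝ) (d₁ : Dec (x zero ≤ᵣ 6/11)) (d₂ : Dec (x (suc zero) ≤ᵣ 6/11)) N →
    seq (density x d₁ d₂) N ≡ rationalDensity (slope d₁) (slope d₂) (λ i → 1ℚ - (scaled x N i ⊓ 1ℚ))
  seq-density n x d₁ d₂ N = cong (recip! (2 ℕ.+ n) *_) (trans
    (seq-sumᵣ (permutations (2 ℕ.+ n))
      (λ σ → F′ (x zero) d₁ *ᵣ uncapturedBefore x σ zero +ᵣ F′ (x (suc zero)) d₂ *ᵣ uncapturedBefore x σ (suc zero)) N)
    (sumOver-cong (permutations (2 ℕ.+ n)) (λ σ → cong₂ _+_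
      (cong₂ _*_ (seq-F′ (x zero) d₁) (seq-uncapturedBefore σ zero))
      (cong₂ _*_ (seq-F′ (x (suc zero)) d₂) (seq-uncapturedBefore σ (suc zero))))))
    where
    seq-F′ : ∀ z d → seq (F′ z d) N ≡ slope d
    seq-F′ z (yes _) = refl
    seq-F′ z (no  _) = refl
    seq-uncapturedBefore : ∀ σ j → seq (uncapturedBefore x σ j) N ≡
                           before (λ i → 1ℚ - (scaled x N i ⊓ 1ℚ)) σ (toℕ (σ ⟨$⟩ʳ j))
    -- `does` of the comparison on `Fin` computes to `<ᵇ` on the underlying naturals, which is the
    -- Boolean that `before` tests.
    seq-uncapturedBefore σ j = seq-productᵣ-filter (λ i → (σ ⟨$⟩ʳ i) <? (σ ⟨$⟩ʳ j)) (λ i → 1ᵣ -ᵣ F (x i)) N (2 ℕ.+ n) (λ i → i)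

  -- The order of rationals is decidable, so refuting x + ε < y at one late index n is enough. Both
  -- sequences move by at most ε/2 from there on, so such a gap would give x ≤ y at all late
  -- indices, against the assumption.
  ≰ᵣ⇒≥ᵣ : ∀ {x y} → ¬ (x ≤ᵣ y) → y ≤ᵣ x
  ≰ᵣ⇒≥ᵣ {x} {y} x≰y ε ε>0 with cauchy x ε′ ε′>0 | cauchy y ε′ ε′>0
    where
    ε′ : ℚ
    ε′ = ½ * ε
    ε′>0 : 0ℚ < ε′
    ε′>0 = CauchyLemmas.half>0 ε ε>0
  ... | K , x-close | L , y-close = K ℕ.⊔ L , λ n K⊔L≤n → ≮⇒≥ (λ x+ε<y → x≰y (λ η η>0 → K ℕ.⊔ L , λ m K⊔L≤m → below η η>0 n m K⊔L≤n K⊔L≤m x+ε<y))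
    where
    open ≤-Reasoning
    below : ∀ η → 0ℚ < η → ∀ n m → K ℕ.⊔ L ℕ.≤ n → K ℕ.⊔ L ℕ.≤ m → seq x n + ε < seq y n → seq x m ≤ seq y m + η
    below η η>0 n m hn hm x+ε<y = begin
      seq x m                       ≤⟨ CauchyLemmas.close⇒≤ {seq x m} (x-close m n (ℕ.m⊔n≤o⇒m≤o K L hm) (ℕ.m⊔n≤o⇒m≤o K L hn)) ⟩
      seq x n + ½ * ε               ≡⟨ rearrange (seq x n) ε ⟩
      seq x n + ε - ½ * ε           ≤⟨ +-monoˡ-≤ (- (½ * ε)) (<⇒≤ x+ε<y) ⟩
      seq y n - ½ * ε               ≤⟨ +-monoˡ-≤ (- (½ * ε)) (CauchyLemmas.close⇒≤ {seq y n} (y-close n m (ℕ.m⊔n≤o⇒n≤o K L hn) (ℕ.m⊔n≤o⇒n≤o K L hm))) ⟩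
      seq y m + ½ * ε - ½ * ε       ≡⟨ cancel (seq y m) (½ * ε) ⟩
      seq y m                       ≤⟨ p≤p+ (seq y m) (<⇒≤ η>0) ⟩
      seq y m + η                   ∎
      where
      rearrange : ∀ p e → p + ½ * e ≡ p + e - ½ * e
      rearrange = solve 2 (λ p e → p :+ con ½ :* e := p :+ e :- con ½ :* e) refl
      cancel : ∀ p e → p + e - e ≡ p
      cancel = solve 2 (λ p e → p :+ e :- e := p) refl

  eventually-all : ∀ k {P : Fin k → ℕ → Set} → (∀ i → ∃[ N ] ∀ n → N ℕ.≤ n → P i n) →
                   ∃[ N ] ∀ n → N ℕ.≤ n → ∀ i → P i n
  eventually-all zero    ev = 0 , λ n _ ()
  eventually-all (suc k) {P} ev with ev zero | eventually-all k (λ i → ev (suc i))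
  ... | K , now | L , later = K ℕ.⊔ L , λ { n h zero    → now n (ℕ.m⊔n≤o⇒m≤o K L h)
                                           ; n h (suc i) → later n (ℕ.m⊔n≤o⇒n≤o K L h) i }

  -- As 11/6 is below 2, an error δ/2 in a coordinate stays within δ after scaling.
  scale-≤ : ∀ p q {δ} → 0ℚ ≤ δ → p ≤ q + ½ * δ → ℤ.+ 11 / 6 * p ≤ ℤ.+ 11 / 6 * q + δ
  scale-≤ p q {δ} 0≤δ p≤ = ≤-trans (*-monoˡ (from-yes (0ℚ ≤? ℤ.+ 11 / 6)) p≤)
    (≤-by (eq q δ) (0≤* (from-yes (0ℚ ≤? ℤ.+ 1 / 12)) 0≤δ))
    where
    eq : ∀ q d → ℤ.+ 11 / 6 * q + d ≡ ℤ.+ 11 / 6 * (q + ½ * d) + ℤ.+ 1 / 12 * d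
    eq = solve 2 (λ q d → con (ℤ.+ 11 / 6) :* q :+ d := con (ℤ.+ 11 / 6) :* (q :+ con ½ :* d) :+ con (ℤ.+ 1 / 12) :* d) refl

  11/6*6/11 : ℤ.+ 11 / 6 * (ℤ.+ 6 / 11) ≡ 1ℚ
  11/6*6/11 = refl

  eventually-side : ∀ {x δ} → 0ℚ < δ → (d : Dec (x ≤ᵣ 6/11)) →
                    ∃[ N ] ∀ n → N ℕ.≤ n → Side d δ (ℤ.+ 11 / 6 * seq x n)
  eventually-side {x} {δ} δ>0 (yes x≤) = proj₁ ev , λ n N≤n →
    subst (λ p → ℤ.+ 11 / 6 * seq x n ≤ p + δ) 11/6*6/11 (scale-≤ (seq x n) (ℤ.+ 6 / 11) (<⇒≤ δ>0) (proj₂ ev n N≤n))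
    where
    ev : ∃[ N ] ∀ n → N ℕ.≤ n → seq x n ≤ ℤ.+ 6 / 11 + ½ * δ
    ev = x≤ (½ * δ) (CauchyLemmas.half>0 δ δ>0)
  eventually-side {x} {δ} δ>0 (no x≰) = proj₁ ev , λ n N≤n →
    subst (λ p → p ≤ ℤ.+ 11 / 6 * seq x n + δ) 11/6*6/11 (scale-≤ (ℤ.+ 6 / 11) (seq x n) (<⇒≤ δ>0) (proj₂ ev n N≤n))
    where
    ev : ∃[ N ] ∀ n → N ℕ.≤ n → ℤ.+ 6 / 11 ≤ seq x n + ½ * δ
    ev = ≰ᵣ⇒≥ᵣ {x} {6/11} x≰ (½ * δ) (CauchyLemmas.half>0 δ δ>0)

  tolerance>0 : ∀ n → 0ℚ < tolerance n
  tolerance>0 n = +-mono-≤-< (0≤* (from-yes (0ℚ ≤? ℤ.+ 4 / 1)) (0≤lipschitz (2 ℕ.+ n))) (positive⁻¹ (ℤ.+ 11 / 1))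

  density-≤ : ∀ n (x : Fin (2 ℕ.+ n) → ℝ) → InSimplex x →
    (d₁ : Dec (x zero ≤ᵣ 6/11)) (d₂ : Dec (x (suc zero) ≤ᵣ 6/11)) → density x d₁ d₂ ≤ᵣ densityBound d₁ d₂
  density-≤ n x simplex d₁ d₂ ε ε>0 = within (CauchyLemmas.divide (tolerance n) ε (tolerance>0 n) ε>0)
    where
    Goal : Set
    Goal = ∃[ N ] ∀ m → N ℕ.≤ m → seq (density x d₁ d₂) m ≤ seq (densityBound d₁ d₂) m + ε

    seq-densityBound : ∀ {P R : Set} (d₁ : Dec P) (d₂ : Dec R) m → seq (densityBound d₁ d₂) m ≡ boundℚ d₁ d₂
    seq-densityBound (yes _) (yes _) m = refl
    seq-densityBound (yes _) (no  _) m = refl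
    seq-densityBound (no  _) (yes _) m = refl
    seq-densityBound (no  _) (no  _) m = refl

    within : (Σ[ δ ∈ ℚ ] 0ℚ < δ × tolerance n * δ ≡ ε) → Goal
    within (δ₀ , δ₀>0 , Cδ₀≡ε) = combine
      (eventually-all (2 ℕ.+ n) (λ i → InSimplex.nonNegative simplex i (½ * δ) ½δ>0))
      (proj₂ (InSimplex.sum≈1 simplex) (½ * δ) ½δ>0)
      (eventually-side {x zero} δ>0 d₁) (eventually-side {x (suc zero)} δ>0 d₂)
      where
      open ≤-Reasoning
      δ : ℚ
      -- δ₀ is ε divided by the total error constant; the cap at 1 is what the perturbation bound
      -- requires.
      δ = δ₀ ⊓ 1ℚ
      δ>0 : 0ℚ < δ
      δ>0 with ⊓-sel δ₀ 1ℚ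
      ... | inj₁ e = subst (0ℚ <_) (sym e) δ₀>0
      ... | inj₂ e = subst (0ℚ <_) (sym e) (positive⁻¹ 1ℚ)
      0≤δ : 0ℚ ≤ δ
      0≤δ = <⇒≤ δ>0
      ½δ>0 : 0ℚ < ½ * δ
      ½δ>0 = CauchyLemmas.half>0 δ δ>0

      combine : (∃[ N ] ∀ m → N ℕ.≤ m → ∀ i → 0ℚ ≤ seq (x i) m + ½ * δ) →
                (∃[ N ] ∀ m → N ℕ.≤ m → 1ℚ ≤ seq (sumᵣ (map x (allFin (2 ℕ.+ n)))) m + ½ * δ) →
                (∃[ N ] ∀ m → N ℕ.≤ m → Side d₁ δ (scaled x m zero)) →
                (∃[ N ] ∀ m → N ℕ.≤ m → Side d₂ δ (scaled x m (suc zero))) → Goal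
      combine (K₁ , 0≤x) (K₂ , 1≤sum) (K₃ , side₁) (K₄ , side₂) =
        K₁ ℕ.⊔ K₂ ℕ.⊔ (K₃ ℕ.⊔ K₄) , λ m h →
          let h₁₂ = ℕ.m⊔n≤o⇒m≤o (K₁ ℕ.⊔ K₂) (K₃ ℕ.⊔ K₄) h
              h₃₄ = ℕ.m⊔n≤o⇒n≤o (K₁ ℕ.⊔ K₂) (K₃ ℕ.⊔ K₄) h
          in at m (0≤x m (ℕ.m⊔n≤o⇒m≤o K₁ K₂ h₁₂)) (1≤sum m (ℕ.m⊔n≤o⇒n≤o K₁ K₂ h₁₂))
                  (side₁ m (ℕ.m⊔n≤o⇒m≤o K₃ K₄ h₃₄)) (side₂ m (ℕ.m⊔n≤o⇒n≤o K₃ K₄ h₃₄))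
        where
        at : ∀ m → (∀ i → 0ℚ ≤ seq (x i) m + ½ * δ) → 1ℚ ≤ seq (sumᵣ (map x (allFin (2 ℕ.+ n)))) m + ½ * δ →
             Side d₁ δ (scaled x m zero) → Side d₂ δ (scaled x m (suc zero)) →
             seq (density x d₁ d₂) m ≤ seq (densityBound d₁ d₂) m + ε
        at m 0≤x 1≤sum side₁ side₂ = begin
          seq (density x d₁ d₂) m
            ≡⟨ seq-density n x d₁ d₂ m ⟩
          rationalDensity (slope d₁) (slope d₂) (λ i → 1ℚ - (scaled x m i ⊓ 1ℚ))
            ≤⟨ rationalDensity-≤ n (scaled x m) 0≤δ total d₁ d₂ (p⊓q≤q δ₀ 1ℚ) 0≤scaled side₁ side₂ ⟩
          boundℚ d₁ d₂ + tolerance n * δ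
            ≤⟨ +-monoʳ-≤ (boundℚ d₁ d₂) (≤-trans (*-monoˡ (<⇒≤ (tolerance>0 n)) (p⊓q≤p δ₀ 1ℚ)) (≤-reflexive Cδ₀≡ε)) ⟩
          boundℚ d₁ d₂ + ε
            ≡⟨ cong (_+ ε) (seq-densityBound d₁ d₂ m) ⟨
          seq (densityBound d₁ d₂) m + ε ∎
          where
          sum≡ : seq (sumᵣ (map x (allFin (2 ℕ.+ n)))) m ≡ Sum (2 ℕ.+ n) (λ i → seq (x i) m)
          sum≡ = trans (seq-sumᵣ (allFin (2 ℕ.+ n)) x m) (sumOver-tabulate (2 ℕ.+ n) (λ i → i) (λ i → seq (x i) m))
          0≤scaled : ∀ i → 0ℚ ≤ scaled x m i + δ
          0≤scaled i = subst (_≤ scaled x m i + δ) (*-zeroʳ (ℤ.+ 11 / 6)) (scale-≤ 0ℚ (seq (x i) m) 0≤δ (0≤x i))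
          total : ℤ.+ 11 / 6 ≤ Sum (2 ℕ.+ n) (scaled x m) + δ
          total = begin
            ℤ.+ 11 / 6                                       ≡⟨ *-identityʳ (ℤ.+ 11 / 6) ⟨
            ℤ.+ 11 / 6 * 1ℚ                                  ≤⟨ scale-≤ 1ℚ (Sum (2 ℕ.+ n) (λ i → seq (x i) m)) 0≤δ
                                                                  (subst (λ p → 1ℚ ≤ p + ½ * δ) sum≡ 1≤sum) ⟩
            ℤ.+ 11 / 6 * Sum (2 ℕ.+ n) (λ i → seq (x i) m) + δ
              ≡⟨ cong (_+ δ) (Sum-*ˡ (2 ℕ.+ n) (ℤ.+ 11 / 6) (λ i → seq (x i) m)) ⟨
            Sum (2 ℕ.+ n) (scaled x m) + δ                   ∎

open import Data.Nat.Base using (_+_)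

lemma6p2 : (m : ℕ) (x : Fin (3 + m) → ℝ) → InSimplex x →
    (x₁≤? : Dec (x zero ≤ᵣ 6/11)) (x₂≤? : Dec (x (suc zero) ≤ᵣ 6/11)) →
    density x x₁≤? x₂≤? ≤ᵣ densityBound x₁≤? x₂≤?
lemma6p2 m = Approximation.density-≤ (suc m)
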